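{- Let $G=(V,E)$ be a finite connected cubic graph. Then the following are equivalent: (i) $\mathrm{Fl}\,G$ satisfies the Jordan–Dedekind condition; (ii) $\mathrm{c\text{ - }rk}\,G\le3$, or $G$ is sober and every edge of $G$ lies in some square; (iii) $\mathrm{c\text{ - }rk}\,G\le3$, or $G\cong K_4$, or $G\cong H_n$ for some $n\ge3$, or $G\cong\tilde H_n$ for some $n\ge4$.
   Context: Graphs are finite, undirected, without loops or multiple edges; cubic means all degrees are 3; a square is a cycle of length 4. $\mathrm{St}(v)$ is the set of neighbours of $v$, $\mathrm{St}(W)=\bigcap_{w\in W}\mathrm{St}(w)$ with $\mathrm{St}(\emptyset)=V$, $\mathrm{Fl}\,G=\{\mathrm{St}(W)\mid W\subseteq V\}$ ordered by inclusion. A lattice satisfies the Jordan–Dedekind condition if all maximal chains have the same length. $G$ is sober if $v\mapsto\mathrm{St}(v)$ is injective. $\mathrm{c\text{ - }rk}\,G$ is the maximum number of independent columns of the $V\times V$ boolean matrix $A^c$ (entry $0$ if $\{i,j\}\in E$, else $1$), where vectors over the superboolean semiring $\{0,1,1^\nu\}$ (with $1+1=1^\nu$, $1^\nu+x=1^\nu$, $0+x=x$, $1\cdot1=1$, $1\cdot1^\nu=1^\nu\cdot1^\nu=1^\nu$, $0\cdot x=0$) are dependent if some nonzero $\{0,1\}$-combination of them has all coordinates in $\{0,1^\nu\}$. $H_n$ has vertices $v_1,\dots,v_n,w_1,\dots,w_n$ and edges $v_iv_{i+1}$, $w_iw_{i+1}$ ($i=1,\dots,n-1$), $v_nv_1$,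 $w_nw_1$, and $v_iw_i$ ($i=1,\dots,n$). $\tilde H_n$ has the same vertices and edges $v_iv_{i+1}$, $w_iw_{i+1}$ ($i=1,\dots,n-1$), $v_iw_i$ ($i=1,\dots,n$), $v_nw_1$ and $w_nv_1$. -}

module Defs where

open import Data.Nat using (ℕ; zero; suc; _≤_; _∸_; _+_)
open import Data.Nat.Properties using (_≟_)
open import Data.Bool using (Bool; true; false; _∧_; _∨_; not; if_then_else_)
open import Data.Fin using (Fin; toℕ; splitAt)
open import Data.Fin.Subset using (Subset; _⊆_; ∣_∣; Nonempty) renaming (_∈_ to _∈ₛ_)
open import Data.Vec using (tabulate; lookup)
open import Data.List using (List; []; _∷_; foldr; allFin; length)
open import Data.List.Relation.Unary.All using (All)
open import Data.List.Relation.Unary.Unique.Propositional using (Unique)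
open import Data.List.Membership.Propositional using (_∈_)
open import Data.Product using (Σ; ∃; ∃-syntax; _×_; _,_)
open import Data.Sum using (_⊎_)
open import Data.Sum using (inj₁; inj₂)
open import Relation.Nullary using (¬_)
open import Relation.Nullary.Decidable using (⌊_⌋)
open import Relation.Binary.PropositionalEquality using (_≡_; _≢_)
open import Function.Bundles using (_↔_; Inverse)

record Graph : Set where
  field
    size : ℕ
    adj  : Fin size → Fin size → Bool
open Graph public

record IsSimple (G : Graph) : Set where
  field
    symmetric   : ∀ x y → adj G x y ≡ adj G y x
    irreflexive : ∀ x → adj G x x ≡ false

St : (G : Graph) → Fin (size G) → Subset (size G)
St G v = tabulate (adj G v)

-- St(W) = ⋂_{w ∈ W} St(w), with St(∅) = V
StW : (G : Graph) → Subset (size G) → Subset (size G)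
StW G W = tabulate λ x → foldr (λ w acc → (not (lookup W w) ∨ adj G w x) ∧ acc) true (allFin (size G))

Cubic : Graph → Set
Cubic G = ∀ v → ∣ St G v ∣ ≡ 3

data Reach (G : Graph) : Fin (size G) → Fin (size G) → Set where
  here : ∀ {x} → Reach G x x
  step : ∀ {x y z} → adj G x y ≡ true → Reach G y z → Reach G x z

Connected : Graph → Set
Connected G = ∀ x y → Reach G x y

Flat : (G : Graph) → Subset (size G) → Set
Flat G X = ∃[ W ] StW G W ≡ X

Comparable : ∀ {n} → Subset n → Subset n → Set
Comparable X Y = X ⊆ Y ⊎ Y ⊆ X

IsChain : (G : Graph) → List (Subset (size G)) → Set
IsChain G C = All (Flat G) C × Unique C × (∀ X Y → X ∈ C → Y ∈ C → Comparable X Y)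

IsMaximalChain : (G : Graph) → List (Subset (size G)) → Set
IsMaximalChain G C =
  IsChain G C × (∀ X → Flat G X → (∀ Y → Y ∈ C → Comparable X Y) → X ∈ C)

chainLength : ∀ {A : Set} → List A → ℕ
chainLength C = length C ∸ 1

JordanDedekind : Graph → Set
JordanDedekind G = ∀ C D → IsMaximalChain G C → IsMaximalChain G D →
  chainLength C ≡ chainLength D

Sober : Graph → Set
Sober G = ∀ v w → St G v ≡ St G w → v ≡ w

EveryEdgeInSquare : Graph → Set
EveryEdgeInSquare G = ∀ a b → adj G a b ≡ true →
  ∃[ c ] ∃[ d ] (a ≢ b × a ≢ c × a ≢ d × b ≢ c × b ≢ d × c ≢ d)
    × adj G b c ≡ true × adj G c d ≡ true × adj G d a ≡ true

data SB : Set where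
  𝟘 𝟙 𝟙ν : SB

_⊕_ : SB → SB → SB
𝟘 ⊕ x = x
𝟙 ⊕ 𝟘 = 𝟙
𝟙 ⊕ 𝟙 = 𝟙ν
𝟙 ⊕ 𝟙ν = 𝟙ν
𝟙ν ⊕ x = 𝟙ν

_⊗_ : SB → SB → SB
𝟘 ⊗ x = 𝟘
𝟙 ⊗ 𝟘 = 𝟘
𝟙 ⊗ 𝟙 = 𝟙
𝟙 ⊗ 𝟙ν = 𝟙ν
𝟙ν ⊗ 𝟘 = 𝟘
𝟙ν ⊗ 𝟙 = 𝟙ν
𝟙ν ⊗ 𝟙ν = 𝟙ν

bool→SB : Bool → SB
bool→SB false = 𝟘
bool→SB true = 𝟙

Ac : (G : Graph) → Fin (size G) → Fin (size G) → SB
Ac G i j = if adj G i j then 𝟘 else 𝟙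

combination : (G : Graph) → Subset (size G) → Fin (size G) → SB
combination G c i =
  foldr (λ j acc → (bool→SB (lookup c j) ⊗ Ac G i j) ⊕ acc) 𝟘 (allFin (size G))

DependentColumns : (G : Graph) → Subset (size G) → Set
DependentColumns G J =
  ∃[ c ] c ⊆ J × Nonempty c × (∀ i → combination G c i ≢ 𝟙)

IndependentColumns : (G : Graph) → Subset (size G) → Set
IndependentColumns G J = ¬ DependentColumns G J

CRankAtMost : Graph → ℕ → Set
CRankAtMost G k = ∀ J → IndependentColumns G J → ∣ J ∣ ≤ k

_≅_ : Graph → Graph → Set
G ≅ H = Σ (Fin (size G) ↔ Fin (size H)) λ f →
  ∀ x y → adj G x y ≡ adj H (Inverse.to f x) (Inverse.to f y)

K4 : Graph
K4 = record { size = 4 ; adj = λ i j → not ⌊ toℕ i ≟ toℕ j ⌋ }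

cycleAdj : (n : ℕ) → Fin n → Fin n → Bool
cycleAdj n i j = ⌊ toℕ j ≟ suc (toℕ i) ⌋ ∨ ⌊ toℕ i ≟ suc (toℕ j) ⌋
  ∨ (⌊ toℕ i ≟ 0 ⌋ ∧ ⌊ suc (toℕ j) ≟ n ⌋) ∨ (⌊ toℕ j ≟ 0 ⌋ ∧ ⌊ suc (toℕ i) ≟ n ⌋)

pathAdj : (n : ℕ) → Fin n → Fin n → Bool
pathAdj n i j = ⌊ toℕ j ≟ suc (toℕ i) ⌋ ∨ ⌊ toℕ i ≟ suc (toℕ j) ⌋

eqFin : ∀ {n} → Fin n → Fin n → Bool
eqFin i j = ⌊ toℕ i ≟ toℕ j ⌋

-- vertices of Fin (n + n): first block v_1..v_n (as v_0..v_{n-1}), second block w's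
H : ℕ → Graph
H n = record { size = n + n ; adj = a }
  where
  a : Fin (n + n) → Fin (n + n) → Bool
  a x y with splitAt n x | splitAt n y
  ... | inj₁ i | inj₁ j = cycleAdj n i j
  ... | inj₂ i | inj₂ j = cycleAdj n i j
  ... | inj₁ i | inj₂ j = eqFin i j
  ... | inj₂ i | inj₁ j = eqFin i j

-- edges v_i v_{i+1}, w_i w_{i+1}, v_i w_i, v_n w_1, w_n v_1
H̃ : ℕ → Graph
H̃ n = record { size = n + n ; adj = a }
  where
  cross : Fin n → Fin n → Bool
  cross i j = eqFin i j
    ∨ (⌊ suc (toℕ i) ≟ n ⌋ ∧ ⌊ toℕ j ≟ 0 ⌋) ∨ (⌊ toℕ i ≟ 0 ⌋ ∧ ⌊ suc (toℕ j) ≟ n ⌋)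
  a : Fin (n + n) → Fin (n + n) → Bool
  a x y with splitAt n x | splitAt n y
  ... | inj₁ i | inj₁ j = pathAdj n i j
  ... | inj₂ i | inj₂ j = pathAdj n i j
  ... | inj₁ i | inj₂ j = cross i j
  ... | inj₂ i | inj₁ j = cross i j

{-# OPTIONS --safe #-}

-- All flats other than V lie in some St(v), so they have at most three elements, and chains of
-- flats have at most four steps. Both c-rk G ≥ 4 and the existence of a chain of four steps mean
-- that some 2-flat {x, y} separates its points, i.e. St(x) ≠ St(y) ("tall"). If G is not tall,
-- a maximal chain contains exactly one flat of size 1 or 2, except in K₃,₃, where it contains
-- none. If G is tall, the Jordan–Dedekind condition excludes the maximal chains
-- ∅ ⊂ {x, y} ⊂ St(a) ⊂ V of twins x, y and ∅ ⊂ {b} ⊂ St(a) ⊂ V of an edge ab in no square;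
-- conversely soberness and squares provide flats of all sizes in every maximal chain.
--
-- In a sober cubic graph with a square on every edge, each vertex has an edge shared by two
-- squares (a rung), and the edge opposite to a rung in a square is again a rung. Following
-- opposite rungs gives a walk along a ladder; its first repetition closes it up on its first rung,
-- with or without a twist.
module Submission where

open import Defs
open import Data.Bool using (Bool; true; false; not; _xor_; _∧_; _∨_)
import Data.Bool.Properties as Bool
open import Data.Empty using (⊥-elim)
open import Data.Fin using (Fin; zero; suc; toℕ; fromℕ<; splitAt; join; _≟_)
open import Data.Fin.Permutation using (↔⇒≡)
import Data.Fin.Properties as Fin
open import Data.Fin.Subset
  using (Subset; ∣_∣; inside; outside; _⊆_; ⊤; ⊥; ⁅_⁆; _∩_; _∪_; Nonempty) renaming (_∈_ to _∈ₛ_)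
open import Data.Fin.Subset.Properties as Subset
  using (p⊆q⇒∣p∣≤∣q∣; p⊂q⇒∣p∣<∣q∣; ⊆-antisym; ⊆-min; ⊆-max; ∈⊤; ∉⊥; ∣⊥∣≡0; ∣⊤∣≡n; x∈⁅x⁆;
    x∈⁅y⁆⇒x≡y; ∣⁅x⁆∣≡1; x∈p∩q⁺; x∈p∩q⁻; x∈p∪q⁺; x∈p∪q⁻; p∩q⊆p; p∩q⊆q; Empty-unique; nonempty?)
open import Data.List using (List; []; _∷_; [_]; _++_; length; map; allFin; foldr)
import Data.List.Membership.DecPropositional as DecMembership
open import Data.List.Membership.Propositional using (_∈_; _∉_; find; lose)
open import Data.List.Membership.Propositional.Properties
  using (∈-∃++; ∈-++⁺ˡ; ∈-++⁺ʳ; ∈-++⁻; ∈-map⁺; ∈-map⁻; ∈-allFin)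
open import Data.List.Properties using (length-map; length-++; length-tabulate)
open import Data.List.Relation.Unary.All as All using (All; []; _∷_)
open import Data.List.Relation.Unary.AllPairs as AllPairs using (AllPairs; []; _∷_)
open import Data.List.Relation.Unary.Any as Any using (here; there)
open import Data.List.Relation.Unary.Linked using (Linked; [-]; _∷_)
open import Data.List.Relation.Unary.Linked.Properties using (Linked⇒AllPairs)
open import Data.List.Relation.Unary.Unique.Propositional using (Unique)
import Data.List.Relation.Unary.Unique.Propositional.Properties as Unique
open import Data.Nat using (ℕ; zero; suc; _≤_; _<_; z≤n; s≤s; s≤s⁻¹; _+_; _∸_)
open import Data.Nat.Induction using (<-rec)
import Data.Nat.Properties as ℕ
open import Data.Product using (∃; ∃-syntax; _×_; _,_; proj₁; proj₂)
open import Data.Sum using (_⊎_; inj₁; inj₂; [_,_]′; swap)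
open import Data.Sum.Properties using (swap-involutive)
open import Data.Vec using ([]; _∷_; here; there; lookup)
import Data.Vec.Properties as Vec
open import Function using (_∘_; case_of_; id)
open import Function.Bundles using (Inverse; mk↔ₛ′; _⇔_; mk⇔)
open import Relation.Binary.Definitions using (tri<; tri≈; tri>)
open import Relation.Binary.PropositionalEquality
  using (_≡_; _≢_; refl; sym; trans; cong; cong₂; subst; subst₂; ≢-sym)
open import Relation.Nullary using (¬_; Dec; yes; no; contradiction)
open import Relation.Nullary.Decidable
  using (⌊_⌋; map′; _×-dec_; _⊎-dec_; _→-dec_; ¬?; decidable-stable; toWitness)

-- Members of a chain are determined by their cardinality, so the length of a maximal chain is found
-- by listing the cardinalities that occur in it. The rank enters through pivots: a superboolean sum
-- equals 1 only if a single term is 1 and the rest are 0, so independent columns can be removed one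
-- at a time along a triangular pattern, whose rows are the vertices `v`, `w`, `u` of a tall graph.
--
-- In the ladder part the difficulty is that a square on an edge need not use the corner that is
-- wanted. Next to a rung one corner of the opposite edge is closed by the known square; the other
-- has to be forced by counting neighbours, while the competing squares trace out K₄ or a cube.
--
-- The bounds on n come from short ladders. With two rungs the untwisted one would return to its
-- start and the twisted one is K₄; with three rungs the twisted one is K₃,₃, which is not sober.
-- The converse rests on the reflection that exchanges the two rails.

-- Counting with duplicate-free lists and subsets

unique-⊆⇒length≤ : ∀ {A : Set} {xs ys : List A} → Unique xs →
  (∀ {x} → x ∈ xs → x ∈ ys) → length xs ≤ length ys
unique-⊆⇒length≤ [] _ = z≤n
unique-⊆⇒length≤ {xs = x ∷ xs} (x∉ ∷ u) sub with ∈-∃++ (sub (here refl))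
... | as , bs , refl = subst (suc (length xs) ≤_) len (s≤s (unique-⊆⇒length≤ u sub′))
  where
  len : suc (length (as ++ bs)) ≡ length (as ++ [ x ] ++ bs)
  len rewrite length-++ as {bs} | length-++ as {[ x ] ++ bs} =
    sym (ℕ.+-suc (length as) (length bs))
  sub′ : ∀ {y} → y ∈ xs → y ∈ as ++ bs
  sub′ y∈ with ∈-++⁻ as (sub (there y∈))
  ... | inj₁ y∈as = ∈-++⁺ˡ y∈as
  ... | inj₂ (here refl) = contradiction refl (All.lookup x∉ y∈)
  ... | inj₂ (there y∈bs) = ∈-++⁺ʳ as y∈bs

elements : ∀ {n} → Subset n → List (Fin n)
elements [] = []
elements (inside ∷ p) = zero ∷ map suc (elements p)
elements (outside ∷ p) = map suc (elements p)

length-elements : ∀ {n} (p : Subset n) → length (elements p) ≡ ∣ p ∣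
length-elements [] = refl
length-elements (inside ∷ p) = cong suc (trans (length-map suc (elements p)) (length-elements p))
length-elements (outside ∷ p) = trans (length-map suc (elements p)) (length-elements p)

∈-elements⁺ : ∀ {n} {p : Subset n} {x} → x ∈ₛ p → x ∈ elements p
∈-elements⁺ here = here refl
∈-elements⁺ {p = inside ∷ p} (there x∈) = there (∈-map⁺ suc (∈-elements⁺ x∈))
∈-elements⁺ {p = outside ∷ p} (there x∈) = ∈-map⁺ suc (∈-elements⁺ x∈)

∈-elements⁻ : ∀ {n} {p : Subset n} {x} → x ∈ elements p → x ∈ₛ p
∈-elements⁻ {p = inside ∷ p} (here refl) = here
∈-elements⁻ {p = inside ∷ p} (there x∈) with _ , y∈ , refl ← ∈-map⁻ suc x∈ =
  there (∈-elements⁻ y∈)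
∈-elements⁻ {p = outside ∷ p} x∈ with _ , y∈ , refl ← ∈-map⁻ suc x∈ = there (∈-elements⁻ y∈)

elements-unique : ∀ {n} (p : Subset n) → Unique (elements p)
elements-unique [] = []
elements-unique (inside ∷ p) =
  All.tabulate (λ y∈ → λ where refl → case ∈-map⁻ suc y∈ of λ ())
  ∷ Unique.map⁺ Fin.suc-injective (elements-unique p)
elements-unique (outside ∷ p) = Unique.map⁺ Fin.suc-injective (elements-unique p)

-- Neighbourhoods in a cubic graph

module CubicGraph (G : Graph) (simple : IsSimple G) (cubic : Cubic G) where

  open IsSimple simple
  open DecMembership (_≟_ {size G}) using (_∈?_)

  V : Set
  V = Fin (size G)

  infix 4 _~_ _~?_

  _~_ : V → V → Set
  x ~ y = adj G x y ≡ true

  _~?_ : ∀ x y → Dec (x ~ y)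
  x ~? y = adj G x y Bool.≟ true

  private variable x y z v w a b c : V

  ~-sym : x ~ y → y ~ x
  ~-sym {x} {y} = trans (symmetric y x)

  ~⇒≢ : x ~ y → x ≢ y
  ~⇒≢ {x} x~y refl with () ← trans (sym x~y) (irreflexive x)

  ∈St⇒~ : x ∈ₛ St G v → v ~ x
  ∈St⇒~ {x} {v} x∈ = trans (sym (Vec.lookup∘tabulate (adj G v) x)) (Vec.[]=⇒lookup x∈)

  ~⇒∈St : v ~ x → x ∈ₛ St G v
  ~⇒∈St {v} {x} v~x =
    Vec.lookup⇒[]= x _ (trans (Vec.lookup∘tabulate (adj G v) x) v~x)

  St≡⇒~ : St G v ≡ St G w → v ~ x → w ~ x
  St≡⇒~ {x = x} e v~x = ∈St⇒~ (subst (x ∈ₛ_) e (~⇒∈St v~x))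

  ~⇒St≡ : (∀ {x} → v ~ x → w ~ x) → (∀ {x} → w ~ x → v ~ x) → St G v ≡ St G w
  ~⇒St≡ f g = Vec.tabulate-cong λ _ → Bool.⇔→≡ (mk⇔ f g)

  degree : ∀ v → length (elements (St G v)) ≡ 3
  degree v = trans (length-elements (St G v)) (cubic v)

  -- Otherwise the three neighbours of `v` would fit into a list of length two.
  fresh : ∀ v xs → length xs ≤ 2 → ∃[ z ] v ~ z × z ∉ xs
  fresh v xs len with Fin.any? (λ z → (v ~? z) ×-dec ¬? (z ∈? xs))
  ... | yes p = p
  ... | no ¬p = contradiction
    (ℕ.≤-trans (ℕ.≤-reflexive (sym (degree v)))
      (ℕ.≤-trans (unique-⊆⇒length≤ (elements-unique (St G v)) sub) len))
    λ { (s≤s (s≤s ())) }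
    where
    sub : ∀ {z} → z ∈ elements (St G v) → z ∈ xs
    sub {z} z∈ = decidable-stable (z ∈? xs) λ z∉ → ¬p (z , ∈St⇒~ (∈-elements⁻ z∈) , z∉)

  neighbour : ∀ v → ∃[ z ] v ~ z
  neighbour v with z , v~z , _ ← fresh v [] z≤n = z , v~z

  another : ∀ v a → ∃[ z ] v ~ z × z ≢ a
  another v a with z , v~z , z∉ ← fresh v (a ∷ []) (s≤s z≤n) = z , v~z , z∉ ∘ here

  third : ∀ v a b → ∃[ z ] v ~ z × z ≢ a × z ≢ b
  third v a b with z , v~z , z∉ ← fresh v (a ∷ b ∷ []) (s≤s (s≤s z≤n)) =
    z , v~z , z∉ ∘ here , λ z≡b → z∉ (there (here z≡b))

  -- A fourth neighbour would exceed the degree. In the ladder arguments this turns an unknown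
  -- neighbour into a choice among three named vertices.
  cover : v ~ a → v ~ b → v ~ c → a ≢ b → a ≢ c → b ≢ c →
    v ~ z → z ≡ a ⊎ z ≡ b ⊎ z ≡ c
  cover {v} {a} {b} {c} {z} va vb vc a≢b a≢c b≢c vz with z ≟ a | z ≟ b | z ≟ c
  ... | yes e | _ | _ = inj₁ e
  ... | no _ | yes e | _ = inj₂ (inj₁ e)
  ... | no _ | no _ | yes e = inj₂ (inj₂ e)
  ... | no z≢a | no z≢b | no z≢c = contradiction
    (ℕ.≤-trans (unique-⊆⇒length≤ u sub) (ℕ.≤-reflexive (degree v)))
    λ { (s≤s (s≤s (s≤s ()))) }
    where
    u : Unique (z ∷ a ∷ b ∷ c ∷ [])
    u = (z≢a ∷ z≢b ∷ z≢c ∷ []) ∷ (a≢b ∷ a≢c ∷ []) ∷ (b≢c ∷ []) ∷ [] ∷ []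
    sub : ∀ {t} → t ∈ z ∷ a ∷ b ∷ c ∷ [] → t ∈ elements (St G v)
    sub (here refl) = ∈-elements⁺ (~⇒∈St vz)
    sub (there (here refl)) = ∈-elements⁺ (~⇒∈St va)
    sub (there (there (here refl))) = ∈-elements⁺ (~⇒∈St vb)
    sub (there (there (there (here refl)))) = ∈-elements⁺ (~⇒∈St vc)

  three-common⇒St≡ : a ≢ b → a ≢ c → b ≢ c →
    v ~ a → v ~ b → v ~ c → w ~ a → w ~ b → w ~ c → St G v ≡ St G w
  three-common⇒St≡ {a} {b} {c} {v} {w} a≢b a≢c b≢c va vb vc wa wb wc = ~⇒St≡ vw wv
    where
    vw : v ~ z → w ~ z
    vw vz with cover va vb vc a≢b a≢c b≢c vz
    ... | inj₁ refl = wa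
    ... | inj₂ (inj₁ refl) = wb
    ... | inj₂ (inj₂ refl) = wc
    wv : w ~ z → v ~ z
    wv wz with cover wa wb wc a≢b a≢c b≢c wz
    ... | inj₁ refl = va
    ... | inj₂ (inj₁ refl) = vb
    ... | inj₂ (inj₂ refl) = vc

  -- Inclusion is enough because all neighbourhoods have three elements.
  St⊆⇒St≡ : (∀ {x} → v ~ x → w ~ x) → St G v ≡ St G w
  St⊆⇒St≡ {v} {w} sub with neighbour v
  ... | a , va with another v a
  ... | b , vb , b≢a with third v a b
  ... | c , vc , c≢a , c≢b =
    three-common⇒St≡ (≢-sym b≢a) (≢-sym c≢a) (≢-sym c≢b) va vb vc (sub va) (sub vb) (sub vc)

  -- Induction along paths, the form in which connectedness enters the proof.
  ~-closed : Connected G → (P : V → Set) → (∀ {x y} → P x → x ~ y → P y) →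
    ∀ {x} → P x → ∀ y → P y
  ~-closed conn P closed {x} px y = go (conn x y) px
    where
    go : ∀ {x y} → Reach G x y → P x → P y
    go here px = px
    go (step e r) px = go r (closed px e)

-- Flats and maximal chains

module _ {n : ℕ} where
  private variable X Y : Subset n

  ⊆∧∣≥∣⇒≡ : X ⊆ Y → ∣ Y ∣ ≤ ∣ X ∣ → X ≡ Y
  ⊆∧∣≥∣⇒≡ {X} {Y} X⊆Y le = ⊆-antisym X⊆Y λ {x} x∈Y →
    decidable-stable (x Subset.∈? X) λ x∉X → ℕ.<⇒≱ (p⊂q⇒∣p∣<∣q∣ (X⊆Y , x , x∈Y , x∉X)) le

  comparable-∣≤∣⇒⊆ : Comparable X Y → ∣ X ∣ ≤ ∣ Y ∣ → X ⊆ Y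
  comparable-∣≤∣⇒⊆ (inj₁ X⊆Y) _ = X⊆Y
  comparable-∣≤∣⇒⊆ (inj₂ Y⊆X) le with refl ← ⊆∧∣≥∣⇒≡ Y⊆X le = id

  -- This lets the cardinality serve as the rank of a member of a chain.
  comparable-∣≡∣⇒≡ : Comparable X Y → ∣ X ∣ ≡ ∣ Y ∣ → X ≡ Y
  comparable-∣≡∣⇒≡ c e =
    ⊆∧∣≥∣⇒≡ (comparable-∣≤∣⇒⊆ c (ℕ.≤-reflexive e)) (ℕ.≤-reflexive (sym e))

  unique⇒length≤∣∣ : ∀ {xs} → Unique xs → (∀ {x} → x ∈ xs → x ∈ₛ X) → length xs ≤ ∣ X ∣
  unique⇒length≤∣∣ {X} u sub = subst (_ ≤_) (length-elements X)
    (unique-⊆⇒length≤ u (∈-elements⁺ ∘ sub))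

  ∣∣≡0⇒⊆ : ∣ X ∣ ≡ 0 → X ⊆ Y
  ∣∣≡0⇒⊆ {X} e {x} x∈ = contradiction
    (subst (1 ≤_) e (unique⇒length≤∣∣ {X = X} ([] ∷ []) λ { (here refl) → x∈ })) λ ()

  ∣∣≥1⇒Nonempty : 1 ≤ ∣ X ∣ → Nonempty X
  ∣∣≥1⇒Nonempty {X} le = decidable-stable (nonempty? X) λ empty →
    contradiction (subst (1 ≤_) (trans (cong ∣_∣ (Empty-unique empty)) (∣⊥∣≡0 n)) le) λ ()

≤3-cases : ∀ {k} → k ≤ 3 → k ≡ 0 ⊎ k ≡ 1 ⊎ k ≡ 2 ⊎ k ≡ 3
≤3-cases z≤n = inj₁ refl
≤3-cases (s≤s z≤n) = inj₂ (inj₁ refl)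
≤3-cases (s≤s (s≤s z≤n)) = inj₂ (inj₂ (inj₁ refl))
≤3-cases (s≤s (s≤s (s≤s z≤n))) = inj₂ (inj₂ (inj₂ refl))

-- The hypotheses make `f` a bijection from `C` onto `L`. With a rank function as `f`, the length of
-- a maximal chain is read off from the ranks that it attains.
transversal-length : ∀ {A : Set} (f : A → ℕ) {C : List A} {L : List ℕ} →
  Unique C → Unique L → (∀ {X} → X ∈ C → f X ∈ L) →
  (∀ {X Y} → X ∈ C → Y ∈ C → f X ≡ f Y → X ≡ Y) →
  (∀ {k} → k ∈ L → ∃[ X ] X ∈ C × f X ≡ k) → length C ≡ length L
transversal-length f {C} {L} uC uL into inj onto = ℕ.≤-antisym
  (subst (_≤ _) (length-map f C) (unique-⊆⇒length≤ (unique-map uC inj) λ k∈ →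
    case ∈-map⁻ f k∈ of λ { (_ , X∈ , refl) → into X∈ }))
  (subst (_ ≤_) (length-map f C) (unique-⊆⇒length≤ uL λ k∈ →
    case onto k∈ of λ { (_ , X∈ , refl) → ∈-map⁺ f X∈ }))
  where
  unique-map : ∀ {C} → Unique C → (∀ {X Y} → X ∈ C → Y ∈ C → f X ≡ f Y → X ≡ Y) →
    Unique (map f C)
  unique-map [] _ = []
  unique-map (X∉ ∷ u) inj =
    All.tabulate (λ k∈ e → case ∈-map⁻ f k∈ of λ where
      (_ , Y∈ , refl) → All.lookup X∉ Y∈ (inj (here refl) (there Y∈) e))
    ∷ unique-map u λ X∈ Y∈ → inj (there X∈) (there Y∈)

module Flats (G : Graph) (simple : IsSimple G) (cubic : Cubic G) where

  open CubicGraph G simple cubic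
  private variable
    x y z v w u a b c : V
    X Y W : Subset (size G)

  ∈StW⁺ : (∀ {w} → w ∈ₛ W → w ~ x) → x ∈ₛ StW G W
  ∈StW⁺ {W} {x} h = Vec.lookup⇒[]= x _ (trans (Vec.lookup∘tabulate _ x) (go (allFin _)))
    where
    go : ∀ xs → foldr (λ w acc → (not (lookup W w) ∨ adj G w x) ∧ acc) true xs ≡ true
    go [] = refl
    go (w ∷ xs) with lookup W w in e
    ... | false = go xs
    ... | true rewrite h (Vec.lookup⇒[]= w W e) = go xs

  ∈StW⁻ : x ∈ₛ StW G W → w ∈ₛ W → w ~ x
  ∈StW⁻ {x} {W} {w} x∈ w∈ =
    go (allFin _) (trans (sym (Vec.lookup∘tabulate _ x)) (Vec.[]=⇒lookup x∈)) (∈-allFin w)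
    where
    go : ∀ xs → foldr (λ w acc → (not (lookup W w) ∨ adj G w x) ∧ acc) true xs ≡ true →
      w ∈ xs → w ~ x
    go (v ∷ xs) e (here refl) rewrite Vec.[]=⇒lookup w∈ with adj G v x
    ... | true = refl
    go (v ∷ xs) e (there w∈xs) with not (lookup W v) ∨ adj G v x
    ... | true = go xs e w∈xs

  flat : ∀ W → (∀ {x} → x ∈ₛ X → ∀ {w} → w ∈ₛ W → w ~ x) →
    (∀ {x} → (∀ {w} → w ∈ₛ W → w ~ x) → x ∈ₛ X) → Flat G X
  flat W f g = W , ⊆-antisym (λ x∈ → g (∈StW⁻ x∈)) λ x∈ → ∈StW⁺ (f x∈)

  ⊤-flat : Flat G ⊤
  ⊤-flat = flat ⊥ (λ _ w∈ → contradiction w∈ ∉⊥) λ _ → ∈⊤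

  ⊥-flat : Flat G ⊥
  -- A common neighbour of all vertices would be adjacent to itself.
  ⊥-flat = flat ⊤ (λ x∈ → contradiction x∈ ∉⊥) λ h → contradiction refl (~⇒≢ (h ∈⊤))

  St-flat : ∀ v → Flat G (St G v)
  St-flat v = flat ⁅ v ⁆ (λ x∈ w∈ → subst (_~ _) (sym (x∈⁅y⁆⇒x≡y v w∈)) (∈St⇒~ x∈))
    λ h → ~⇒∈St (h (x∈⁅x⁆ v))

  ∩-flat : Flat G X → Flat G Y → Flat G (X ∩ Y)
  ∩-flat (U , refl) (W , refl) = flat (U ∪ W)
    (λ x∈ w∈ → case x∈p∩q⁻ (StW G U) (StW G W) x∈ of λ where
      (x∈U , x∈W) → [ ∈StW⁻ x∈U , ∈StW⁻ x∈W ]′ (x∈p∪q⁻ U W w∈))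
    λ h → x∈p∩q⁺ (∈StW⁺ (h ∘ x∈p∪q⁺ ∘ inj₁) , ∈StW⁺ (h ∘ x∈p∪q⁺ ∘ inj₂))

  flat-⊤⊎⊆St : Flat G X → X ≡ ⊤ ⊎ (∃[ w ] X ⊆ St G w)
  flat-⊤⊎⊆St {X} (W , refl) with nonempty? W
  ... | yes (w , w∈) = inj₂ (w , λ x∈ → ~⇒∈St (∈StW⁻ x∈ w∈))
  ... | no empty = inj₁ (⊆-antisym (⊆-max _) λ _ → ∈StW⁺ λ w∈ → contradiction (_ , w∈) empty)

  ⊆St⇒∣∣≤3 : X ⊆ St G w → ∣ X ∣ ≤ 3
  ⊆St⇒∣∣≤3 {w = w} sub = subst (_ ≤_) (cubic w) (p⊆q⇒∣p∣≤∣q∣ sub)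

  ∣St∣<∣⊤∣ : ∀ v → 3 < ∣ ⊤ {size G} ∣
  ∣St∣<∣⊤∣ v = subst (_< ∣ ⊤ {size G} ∣) (cubic v)
    (p⊂q⇒∣p∣<∣q∣ (⊆-max _ , v , ∈⊤ , λ v∈ → ~⇒≢ (∈St⇒~ v∈) refl))

  ∩-∣∣≡3⇒St≡ : ∣ St G v ∩ St G w ∣ ≡ 3 → St G v ≡ St G w
  ∩-∣∣≡3⇒St≡ {v} {w} e = trans
    (sym (⊆∧∣≥∣⇒≡ (p∩q⊆p _ _) (ℕ.≤-reflexive (trans (cubic v) (sym e)))))
    (⊆∧∣≥∣⇒≡ (p∩q⊆q _ _) (ℕ.≤-reflexive (trans (cubic w) (sym e))))

  ∩-∣∣≡2 : v ~ x → v ~ y → w ~ x → w ~ y → x ≢ y → St G v ≢ St G w → ∣ St G v ∩ St G w ∣ ≡ 2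
  ∩-∣∣≡2 vx vy wx wy x≢y v≢w = ℕ.≤-antisym
    (s≤s⁻¹ (ℕ.≤∧≢⇒< (⊆St⇒∣∣≤3 (p∩q⊆p _ _)) (v≢w ∘ ∩-∣∣≡3⇒St≡)))
    (unique⇒length≤∣∣ ((x≢y ∷ []) ∷ [] ∷ []) λ where
      (here refl) → x∈p∩q⁺ (~⇒∈St vx , ~⇒∈St wx)
      (there (here refl)) → x∈p∩q⁺ (~⇒∈St vy , ~⇒∈St wy))

  -- ⊥ ⊂ {x} ⊂ {x, y} ⊂ {x, y, z} ⊂ ⊤ is a chain of flats, cut out by u, w and v.
  Tall : Set
  Tall = ∃[ v ] ∃[ w ] ∃[ u ] ∃[ x ] ∃[ y ] ∃[ z ]
    v ~ x × v ~ y × v ~ z × w ~ x × w ~ y × ¬ w ~ z × u ~ x × ¬ u ~ y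

  tall? : Dec Tall
  tall? = Fin.any? λ v → Fin.any? λ w → Fin.any? λ u → Fin.any? λ x → Fin.any? λ y → Fin.any? λ z →
    v ~? x ×-dec v ~? y ×-dec v ~? z ×-dec w ~? x ×-dec w ~? y ×-dec ¬? (w ~? z) ×-dec
    u ~? x ×-dec ¬? (u ~? y)

  infix 4 _⊏_
  _⊏_ : Subset (size G) → Subset (size G) → Set
  X ⊏ Y = X ⊆ Y × ∣ X ∣ < ∣ Y ∣

  ascending⇒chain : ∀ {C} → Linked _⊏_ C → All (Flat G) C → IsChain G C
  ascending⇒chain {C} l flats = flats , AllPairs.map (λ { (_ , lt) refl → ℕ.<-irrefl refl lt }) pairs
    , λ _ _ → comparable pairs
    where
    pairs : AllPairs _⊏_ C
    pairs = Linked⇒AllPairs (λ (s , l) (s′ , l′) → (λ x → s′ (s x)) , ℕ.<-trans l l′) l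
    comparable : ∀ {C X Y} → AllPairs _⊏_ C → X ∈ C → Y ∈ C → Comparable X Y
    comparable (_ ∷ _) (here refl) (here refl) = inj₁ id
    comparable (X⊏ ∷ _) (here refl) (there Y∈) = inj₁ (proj₁ (All.lookup X⊏ Y∈))
    comparable (Y⊏ ∷ _) (there X∈) (here refl) = inj₂ (proj₁ (All.lookup Y⊏ X∈))
    comparable (_ ∷ p) (there X∈) (there Y∈) = comparable p X∈ Y∈

  Intermediate : Subset (size G) → Set
  Intermediate X = ∣ X ∣ ≡ 1 ⊎ ∣ X ∣ ≡ 2

  intermediate-cards : ∀ v → Intermediate X → ∣ ⊥ {size G} ∣ < ∣ X ∣ × ∣ X ∣ < ∣ St G v ∣
  intermediate-cards {X = F} v mid rewrite ∣⊥∣≡0 (size G) | cubic v with mid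
  ... | inj₁ e rewrite e = s≤s z≤n , s≤s (s≤s z≤n)
  ... | inj₂ e rewrite e = s≤s z≤n , s≤s (s≤s (s≤s z≤n))

  module _ {F} (flatF : Flat G F) (F⊆ : F ⊆ St G v) (mid : Intermediate F) where

    -- A flat other than V has at most three elements. If it is comparable with all members, size 0
    -- makes it `⊥` and size 3 makes it `St G v`; sizes 1 and 2 are left to the hypothesis.
    four-chain-maximal :
      (∀ {X} → Flat G X → X ⊆ St G v → Comparable X F → Intermediate X → X ≡ F) →
      IsMaximalChain G (⊥ ∷ F ∷ St G v ∷ ⊤ ∷ [])
    four-chain-maximal only =
      ascending⇒chain
        ((⊆-min _ , proj₁ (intermediate-cards {X = F} v mid)) ∷
          (F⊆ , proj₂ (intermediate-cards {X = F} v mid)) ∷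
          (⊆-max _ , subst (_< _) (sym (cubic v)) (∣St∣<∣⊤∣ v)) ∷ [-])
        (⊥-flat ∷ flatF ∷ St-flat v ∷ ⊤-flat ∷ [])
      , λ X flatX cmp → maximal flatX cmp (flat-⊤⊎⊆St flatX)
      where
      maximal : Flat G X → (∀ Y → Y ∈ (⊥ ∷ F ∷ St G v ∷ ⊤ ∷ []) → Comparable X Y) →
        X ≡ ⊤ ⊎ (∃[ w ] X ⊆ St G w) → X ∈ ⊥ ∷ F ∷ St G v ∷ ⊤ ∷ []
      maximal _ _ (inj₁ refl) = there (there (there (here refl)))
      maximal {X} flatX cmp (inj₂ (w , X⊆)) = cases (≤3-cases (⊆St⇒∣∣≤3 X⊆))
        where
        inside-St : X ⊆ St G v
        inside-St = comparable-∣≤∣⇒⊆ (cmp _ (there (there (here refl))))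
          (subst (_ ≤_) (sym (cubic v)) (⊆St⇒∣∣≤3 X⊆))
        intermediate : Intermediate X → X ∈ ⊥ ∷ F ∷ St G v ∷ ⊤ ∷ []
        intermediate m = there (here (only flatX inside-St (cmp _ (there (here refl))) m))
        cases : ∣ X ∣ ≡ 0 ⊎ ∣ X ∣ ≡ 1 ⊎ ∣ X ∣ ≡ 2 ⊎ ∣ X ∣ ≡ 3 → X ∈ ⊥ ∷ F ∷ St G v ∷ ⊤ ∷ []
        cases (inj₁ e) =
          here (comparable-∣≡∣⇒≡ (cmp _ (here refl)) (trans e (sym (∣⊥∣≡0 (size G)))))
        cases (inj₂ (inj₁ e)) = intermediate (inj₁ e)
        cases (inj₂ (inj₂ (inj₁ e))) = intermediate (inj₂ e)
        cases (inj₂ (inj₂ (inj₂ e))) = there (there (here (comparable-∣≡∣⇒≡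
          (cmp _ (there (there (here refl)))) (trans e (sym (cubic v))))))

    -- The five-chain of a tall graph shows that all maximal chains have length four.
    ¬unique-intermediate : JordanDedekind G → Tall →
      ¬ (∀ {X} → Flat G X → X ⊆ St G v → Comparable X F → Intermediate X → X ≡ F)
    ¬unique-intermediate jd tall only = case jd _ _ (four-chain-maximal only) (five-chain-maximal tall) of λ ()
      where
      five-chain : Tall → List (Subset (size G))
      five-chain (v , w , u , _) = ⊥ ∷ (St G v ∩ St G w) ∩ St G u ∷ St G v ∩ St G w ∷ St G v ∷ ⊤ ∷ []
      five-chain-maximal : ∀ t → IsMaximalChain G (five-chain t)
      five-chain-maximal t@(v , w , u , x , y , z , vx , vy , vz , wx , wy , ¬wz , ux , ¬uy) =
        ascending⇒chain
          ((⊆-min _ , subst (_< ∣ F₁ ∣) (sym (∣⊥∣≡0 (size G))) 0<F₁) ∷ (p∩q⊆p _ _ , F₁<F₂) ∷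
            (p∩q⊆p _ _ , subst (∣ F₂ ∣ <_) (sym (cubic v)) F₂<3) ∷
            (⊆-max _ , subst (_< _) (sym (cubic v)) (∣St∣<∣⊤∣ v)) ∷ [-])
          (⊥-flat ∷ ∩-flat F₂-flat (St-flat u) ∷ F₂-flat ∷ St-flat v ∷ ⊤-flat ∷ [])
        , λ X flatX cmp → maximal cmp (flat-⊤⊎⊆St flatX)
        where
        F₂ = St G v ∩ St G w
        F₁ = F₂ ∩ St G u
        F₂-flat : Flat G F₂
        F₂-flat = ∩-flat (St-flat v) (St-flat w)
        y∈F₂ : y ∈ₛ F₂
        y∈F₂ = x∈p∩q⁺ (~⇒∈St vy , ~⇒∈St wy)
        0<F₁ : 0 < ∣ F₁ ∣
        0<F₁ = unique⇒length≤∣∣ {X = F₁} ([] ∷ []) λ where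
          (here refl) → x∈p∩q⁺ (x∈p∩q⁺ (~⇒∈St vx , ~⇒∈St wx) , ~⇒∈St ux)
        F₁<F₂ : ∣ F₁ ∣ < ∣ F₂ ∣
        F₁<F₂ = p⊂q⇒∣p∣<∣q∣ (p∩q⊆p _ _ , y , y∈F₂ , λ y∈ → ¬uy (∈St⇒~ (proj₂ (x∈p∩q⁻ F₂ _ y∈))))
        F₂<3 : ∣ F₂ ∣ < 3
        F₂<3 = subst (∣ F₂ ∣ <_) (cubic v) (p⊂q⇒∣p∣<∣q∣
          (p∩q⊆p _ _ , z , ~⇒∈St vz , λ z∈ → ¬wz (∈St⇒~ (proj₂ (x∈p∩q⁻ (St G v) _ z∈)))))
        -- Since 0 < ∣F₁∣ < ∣F₂∣ < 3, the sizes are forced to be 1 and 2, and the chain then has a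
        -- member of every size that a flat can have.
        ∣F₂∣ : ∣ F₂ ∣ ≡ 2
        ∣F₂∣ = ℕ.≤-antisym (s≤s⁻¹ F₂<3) (ℕ.<-≤-trans (s≤s 0<F₁) F₁<F₂)
        ∣F₁∣ : ∣ F₁ ∣ ≡ 1
        ∣F₁∣ = ℕ.≤-antisym (s≤s⁻¹ (subst (∣ F₁ ∣ <_) ∣F₂∣ F₁<F₂)) 0<F₁
        maximal : (∀ Y → Y ∈ five-chain t → Comparable X Y) →
          X ≡ ⊤ ⊎ (∃[ w ] X ⊆ St G w) → X ∈ five-chain t
        maximal _ (inj₁ refl) = there (there (there (there (here refl))))
        maximal {X} cmp (inj₂ (_ , X⊆)) with ≤3-cases (⊆St⇒∣∣≤3 X⊆)
        ... | inj₁ e = here (comparable-∣≡∣⇒≡ (cmp _ (here refl)) (trans e (sym (∣⊥∣≡0 (size G)))))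
        ... | inj₂ (inj₁ e) = there (here (comparable-∣≡∣⇒≡
          (cmp _ (there (here refl))) (trans e (sym ∣F₁∣))))
        ... | inj₂ (inj₂ (inj₁ e)) = there (there (here (comparable-∣≡∣⇒≡
          (cmp _ (there (there (here refl)))) (trans e (sym ∣F₂∣)))))
        ... | inj₂ (inj₂ (inj₂ e)) = there (there (there (here (comparable-∣≡∣⇒≡
          (cmp _ (there (there (there (here refl))))) (trans e (sym (cubic v)))))))

-- Independent columns

remove : ∀ {A : Set} {j : A} {xs} → Unique xs → j ∈ xs →
  ∃[ ys ] suc (length ys) ≡ length xs × Unique ys × (∀ {k} → k ∈ ys → k ∈ xs × k ≢ j)
remove {xs = _ ∷ xs} (j∉ ∷ u) (here refl) =
  xs , refl , u , λ k∈ → there k∈ , ≢-sym (All.lookup j∉ k∈)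
remove {xs = x ∷ _} (x∉ ∷ u) (there j∈) with remove u j∈
... | ys , len , u′ , sub =
  x ∷ ys , cong suc len , All.tabulate (λ k∈ → All.lookup x∉ (proj₁ (sub k∈))) ∷ u′ , λ where
    (here refl) → here refl , All.lookup x∉ j∈
    (there k∈) → there (proj₁ (sub k∈)) , proj₂ (sub k∈)

⊕≡𝟘 : ∀ {s t} → s ⊕ t ≡ 𝟘 → s ≡ 𝟘 × t ≡ 𝟘
⊕≡𝟘 {𝟘} {𝟘} _ = refl , refl
⊕≡𝟘 {𝟙} {𝟘} ()
⊕≡𝟘 {𝟙} {𝟙} ()
⊕≡𝟘 {𝟙} {𝟙ν} ()

⊕≡𝟙 : ∀ {s t} → s ⊕ t ≡ 𝟙 → s ≡ 𝟙 × t ≡ 𝟘 ⊎ s ≡ 𝟘 × t ≡ 𝟙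
⊕≡𝟙 {𝟘} {𝟙} _ = inj₂ (refl , refl)
⊕≡𝟙 {𝟙} {𝟘} _ = inj₁ (refl , refl)
⊕≡𝟙 {𝟙} {𝟙} ()
⊕≡𝟙 {𝟙} {𝟙ν} ()

𝟙≟ : ∀ s → Dec (s ≡ 𝟙)
𝟙≟ 𝟘 = no λ ()
𝟙≟ 𝟙 = yes refl
𝟙≟ 𝟙ν = no λ ()

module _ {A : Set} (f : A → SB) where

  ⊕-sum : List A → SB
  ⊕-sum = foldr (λ j acc → f j ⊕ acc) 𝟘

  ⊕-sum≡𝟘⁺ : ∀ xs → (∀ {k} → k ∈ xs → f k ≡ 𝟘) → ⊕-sum xs ≡ 𝟘
  ⊕-sum≡𝟘⁺ [] _ = refl
  ⊕-sum≡𝟘⁺ (x ∷ xs) h rewrite h (here refl) = ⊕-sum≡𝟘⁺ xs (h ∘ there)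

  ⊕-sum≡𝟘⁻ : ∀ xs → ⊕-sum xs ≡ 𝟘 → ∀ {k} → k ∈ xs → f k ≡ 𝟘
  ⊕-sum≡𝟘⁻ (x ∷ xs) e (here refl) = proj₁ (⊕≡𝟘 e)
  ⊕-sum≡𝟘⁻ (x ∷ xs) e (there k∈) = ⊕-sum≡𝟘⁻ xs (proj₂ (⊕≡𝟘 {f x} e)) k∈

  -- Addition never leaves the ghost value `𝟙ν`, and two terms `𝟙` already reach it. Hence a sum is
  -- `𝟙` exactly when one term is `𝟙` and all others are `𝟘`.
  ⊕-sum≡𝟙⁺ : ∀ {xs j} → Unique xs → j ∈ xs → f j ≡ 𝟙 →
    (∀ {k} → k ∈ xs → k ≢ j → f k ≡ 𝟘) → ⊕-sum xs ≡ 𝟙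
  ⊕-sum≡𝟙⁺ {x ∷ xs} (x∉ ∷ _) (here refl) fj h
    rewrite fj | ⊕-sum≡𝟘⁺ xs (λ k∈ → h (there k∈) (≢-sym (All.lookup x∉ k∈))) = refl
  ⊕-sum≡𝟙⁺ {x ∷ xs} (x∉ ∷ u) (there j∈) fj h
    rewrite h (here refl) (All.lookup x∉ j∈) = ⊕-sum≡𝟙⁺ u j∈ fj (h ∘ there)

  ⊕-sum≡𝟙⁻ : ∀ xs → ⊕-sum xs ≡ 𝟙 →
    ∃[ j ] j ∈ xs × f j ≡ 𝟙 × (∀ {k} → k ∈ xs → k ≢ j → f k ≡ 𝟘)
  ⊕-sum≡𝟙⁻ (x ∷ xs) e with ⊕≡𝟙 {f x} e
  ... | inj₁ (fx , rest) = x , here refl , fx , λ where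
    (here refl) k≢ → contradiction refl k≢
    (there k∈) _ → ⊕-sum≡𝟘⁻ xs rest k∈
  ... | inj₂ (fx , rest) with ⊕-sum≡𝟙⁻ xs rest
  ... | j , j∈ , fj , others = j , there j∈ , fj , λ where
    (here refl) _ → fx
    (there k∈) k≢ → others k∈ k≢

fromList : ∀ {n} → List (Fin n) → Subset n
fromList = foldr (λ x X → ⁅ x ⁆ ∪ X) ⊥

∈-fromList⁺ : ∀ {n} {x : Fin n} {xs} → x ∈ xs → x ∈ₛ fromList xs
∈-fromList⁺ (here refl) = x∈p∪q⁺ (inj₁ (x∈⁅x⁆ _))
∈-fromList⁺ {xs = y ∷ _} (there x∈) = x∈p∪q⁺ {p = ⁅ y ⁆} (inj₂ (∈-fromList⁺ x∈))

∈-fromList⁻ : ∀ {n} {x : Fin n} xs → x ∈ₛ fromList xs → x ∈ xs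
∈-fromList⁻ [] x∈ = contradiction x∈ ∉⊥
∈-fromList⁻ (y ∷ xs) x∈ with x∈p∪q⁻ ⁅ y ⁆ (fromList xs) x∈
... | inj₁ x∈y = here (x∈⁅y⁆⇒x≡y y x∈y)
... | inj₂ x∈xs = there (∈-fromList⁻ xs x∈xs)

module JordanDedekindRank (G : Graph) (simple : IsSimple G) (cubic : Cubic G) where

  open CubicGraph G simple cubic
  open Flats G simple cubic
  private variable
    x y z v w u a b c : V
    X Y J : Subset (size G)

  term : Subset (size G) → V → V → SB
  term X i j = bool→SB (lookup X j) ⊗ Ac G i j

  term≡𝟙⁺ : ∀ {i j} → j ∈ₛ X → ¬ i ~ j → term X i j ≡ 𝟙
  term≡𝟙⁺ {i = i} {j} j∈ ¬ij rewrite Vec.[]=⇒lookup j∈ | Bool.¬-not ¬ij = refl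

  term≡𝟙⁻ : ∀ {i j} → term X i j ≡ 𝟙 → j ∈ₛ X × ¬ i ~ j
  term≡𝟙⁻ {X} {i} {j} e with lookup X j in ej | adj G i j
  ... | true | false = Vec.lookup⇒[]= j X ej , λ ()

  term≡𝟘⁺ : ∀ {i j} → (j ∈ₛ X → i ~ j) → term X i j ≡ 𝟘
  term≡𝟘⁺ {X} {i} {j} h with lookup X j in ej
  ... | false = refl
  ... | true rewrite h (Vec.lookup⇒[]= j X ej) = refl

  term≡𝟘⁻ : ∀ {i j} → term X i j ≡ 𝟘 → j ∈ₛ X → i ~ j
  term≡𝟘⁻ {X} {i} {j} e j∈ rewrite Vec.[]=⇒lookup j∈ with adj G i j
  ... | true = refl

  -- Among the columns in `X`, row `i` of A^c has its single entry 1 in column `j`: the entries 0 of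
  -- A^c are the edges. Such rows are exactly the coordinates where the sum of the columns in `X` is
  -- `𝟙`.
  Pivot : Subset (size G) → V → V → Set
  Pivot X i j = j ∈ₛ X × ¬ i ~ j × (∀ {k} → k ∈ₛ X → k ≢ j → i ~ k)

  pivot⇒combination≡𝟙 : ∀ {i j} → Pivot X i j → combination G X i ≡ 𝟙
  pivot⇒combination≡𝟙 {X} {i} {j} (j∈ , ¬ij , others) =
    ⊕-sum≡𝟙⁺ (term X i) (Unique.allFin⁺ _) (∈-allFin j) (term≡𝟙⁺ {X} j∈ ¬ij)
      λ _ k≢ → term≡𝟘⁺ {X} λ k∈ → others k∈ k≢

  combination≡𝟙⇒pivot : ∀ {i} → combination G X i ≡ 𝟙 → ∃[ j ] Pivot X i j
  combination≡𝟙⇒pivot {X} {i} e with ⊕-sum≡𝟙⁻ (term X i) (allFin _) e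
  ... | j , _ , fj , others = j , proj₁ (term≡𝟙⁻ {X} fj) , proj₂ (term≡𝟙⁻ {X} fj) ,
    λ k∈ k≢ → term≡𝟘⁻ {X} (others (∈-allFin _) k≢) k∈

  -- Without a pivot row, `X` itself would be a dependent combination.
  independent⇒pivot : IndependentColumns G J → X ⊆ J → Nonempty X → ∃[ i ] ∃[ j ] Pivot X i j
  independent⇒pivot {J} {X} ind X⊆J nonempty with Fin.any? (λ i → 𝟙≟ (combination G X i))
  ... | yes (i , e) = i , combination≡𝟙⇒pivot e
  ... | no none = ⊥-elim (ind (X , X⊆J , nonempty , λ i e → none (i , e)))

  -- Removing the pivot column leaves columns in which row `i` vanishes, so repeated peeling
  -- produces a triangular matrix row by row.
  peel : IndependentColumns G J → ∀ {k xs} → Unique xs → (∀ {x} → x ∈ xs → x ∈ₛ J) →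
    length xs ≡ suc k → ∃[ i ] ∃[ j ] ∃[ ys ] length ys ≡ k × Unique ys ×
      j ∈ xs × ¬ i ~ j × (∀ {x} → x ∈ ys → x ∈ xs × i ~ x)
  peel ind {k} {xs@(x ∷ _)} u sub len
    with independent⇒pivot ind (sub ∘ ∈-fromList⁻ xs) (x , ∈-fromList⁺ {xs = xs} (here refl))
  ... | i , j , j∈ , ¬ij , others with remove u (∈-fromList⁻ xs j∈)
  ... | ys , len′ , u′ , sub′ = i , j , ys , ℕ.suc-injective (trans len′ len) , u′
    , ∈-fromList⁻ xs j∈ , ¬ij , λ x∈ →
      proj₁ (sub′ x∈) , others (∈-fromList⁺ {xs = xs} (proj₁ (sub′ x∈))) (proj₂ (sub′ x∈))

  independent-four⇒tall : IndependentColumns G J → 4 ≤ ∣ J ∣ → Tall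
  independent-four⇒tall {J} ind four =
    start (elements J) (elements-unique J) (subst (4 ≤_) (sym (length-elements J)) four) ∈-elements⁻
    where
    -- Three peels suffice. The second and third pivot columns are `z` and `y`, and `x` is the
    -- column that remains; each row found is adjacent to all columns that survive it.
    descend : ∀ {xs} → Unique xs → (∀ {x} → x ∈ xs → x ∈ₛ J) → length xs ≡ 4 → Tall
    descend u₀ sub₀ len₀
      with v , _ , _ , len₁ , u₁ , _ , _ , sub₁ ← peel ind u₀ sub₀ len₀
      with w , z , _ , len₂ , u₂ , z∈ , ¬wz , sub₂ ← peel ind u₁ (sub₀ ∘ proj₁ ∘ sub₁) len₁
      with u , y , x ∷ _ , _ , _ , y∈ , ¬uy , sub₃ ←
        peel ind u₂ (sub₀ ∘ proj₁ ∘ sub₁ ∘ proj₁ ∘ sub₂) len₂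
      = let x∈ , ux = sub₃ (here refl) in
        v , w , u , x , y , z
        , proj₂ (sub₁ (proj₁ (sub₂ x∈))) , proj₂ (sub₁ (proj₁ (sub₂ y∈))) , proj₂ (sub₁ z∈)
        , proj₂ (sub₂ x∈) , proj₂ (sub₂ y∈) , ¬wz , ux , ¬uy
    start : ∀ xs → Unique xs → 4 ≤ length xs → (∀ {x} → x ∈ xs → x ∈ₛ J) → Tall
    start (a ∷ b ∷ c ∷ d ∷ _) ((a≢b ∷ a≢c ∷ a≢d ∷ _) ∷ (b≢c ∷ b≢d ∷ _) ∷ (c≢d ∷ _) ∷ _) _ sub =
      descend ((a≢b ∷ a≢c ∷ a≢d ∷ []) ∷ (b≢c ∷ b≢d ∷ []) ∷ (c≢d ∷ []) ∷ [] ∷ []) (λ where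
        (here refl) → sub (here refl)
        (there (here refl)) → sub (there (here refl))
        (there (there (here refl))) → sub (there (there (here refl)))
        (there (there (there (here refl)))) → sub (there (there (there (here refl))))) refl
    start [] _ ()
    start (_ ∷ []) _ (s≤s ())
    start (_ ∷ _ ∷ []) _ (s≤s (s≤s ()))
    start (_ ∷ _ ∷ _ ∷ []) _ (s≤s (s≤s (s≤s ())))

  ¬tall⇒rank≤3 : ¬ Tall → CRankAtMost G 3
  ¬tall⇒rank≤3 ¬tall J ind = ℕ.≮⇒≥ λ four → ¬tall (independent-four⇒tall ind four)

  -- On the columns x, y, z, v the rows x, u, w, v form a triangular matrix.
  rank≤3⇒¬tall : CRankAtMost G 3 → ¬ Tall
  rank≤3⇒¬tall rank (v , w , u , x , y , z , vx , vy , vz , wx , wy , ¬wz , ux , ¬uy) =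
    ℕ.<⇒≱ (unique⇒length≤∣∣ {X = fromList xs} unique ∈-fromList⁺) (rank (fromList xs) independent)
    where
    xs = x ∷ y ∷ z ∷ v ∷ []
    unique : Unique xs
    unique = ((λ { refl → ¬uy ux }) ∷ (λ { refl → ¬wz wx }) ∷ ≢-sym (~⇒≢ vx) ∷ [])
      ∷ ((λ { refl → ¬wz wy }) ∷ ≢-sym (~⇒≢ vy) ∷ []) ∷ (≢-sym (~⇒≢ vz) ∷ []) ∷ [] ∷ []
    independent : IndependentColumns G (fromList xs)
    independent (c , c⊆ , (k , k∈) , ≢𝟙)
      -- The last column of the order `x`, `y`, `z`, `v` that occurs in `c` is a pivot, in row `x`,
      -- `u`, `w` or `v` respectively.
      with v Subset.∈? c | z Subset.∈? c | y Subset.∈? c | x Subset.∈? c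
    ... | yes v∈ | _ | _ | _ = ≢𝟙 v (pivot⇒combination≡𝟙 (v∈ , (λ vv → ~⇒≢ vv refl) , others))
      where
      others : ∀ {k} → k ∈ₛ c → k ≢ v → v ~ k
      others k∈ k≢ with ∈-fromList⁻ xs (c⊆ k∈)
      ... | here refl = vx
      ... | there (here refl) = vy
      ... | there (there (here refl)) = vz
      ... | there (there (there (here refl))) = contradiction refl k≢
    ... | no v∉ | yes z∈ | _ | _ = ≢𝟙 w (pivot⇒combination≡𝟙 (z∈ , ¬wz , others))
      where
      others : ∀ {k} → k ∈ₛ c → k ≢ z → w ~ k
      others k∈ k≢ with ∈-fromList⁻ xs (c⊆ k∈)
      ... | here refl = wx
      ... | there (here refl) = wy
      ... | there (there (here refl)) = contradiction refl k≢
      ... | there (there (there (here refl))) = contradiction k∈ v∉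
    ... | no v∉ | no z∉ | yes y∈ | _ = ≢𝟙 u (pivot⇒combination≡𝟙 (y∈ , ¬uy , others))
      where
      others : ∀ {k} → k ∈ₛ c → k ≢ y → u ~ k
      others k∈ k≢ with ∈-fromList⁻ xs (c⊆ k∈)
      ... | here refl = ux
      ... | there (here refl) = contradiction refl k≢
      ... | there (there (here refl)) = contradiction k∈ z∉
      ... | there (there (there (here refl))) = contradiction k∈ v∉
    ... | no v∉ | no z∉ | no y∉ | yes x∈ =
      ≢𝟙 x (pivot⇒combination≡𝟙 (x∈ , (λ xx → ~⇒≢ xx refl) , others))
      where
      others : ∀ {k} → k ∈ₛ c → k ≢ x → x ~ k
      others k∈ k≢ with ∈-fromList⁻ xs (c⊆ k∈)
      ... | here refl = contradiction refl k≢
      ... | there (here refl) = contradiction k∈ y∉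
      ... | there (there (here refl)) = contradiction k∈ z∉
      ... | there (there (there (here refl))) = contradiction k∈ v∉
    ... | no v∉ | no z∉ | no y∉ | no x∉ with ∈-fromList⁻ xs (c⊆ k∈)
    ... | here refl = x∉ k∈
    ... | there (here refl) = y∉ k∈
    ... | there (there (here refl)) = z∉ k∈
    ... | there (there (there (here refl))) = v∉ k∈

-- The Jordan–Dedekind condition

∣∣≥2⇒another : ∀ {n} {X : Subset n} x → 2 ≤ ∣ X ∣ → ∃[ y ] y ∈ₛ X × y ≢ x
∣∣≥2⇒another {X = X} x le with Fin.any? (λ y → (y Subset.∈? X) ×-dec ¬? (y ≟ x))
... | yes p = p
... | no none = contradiction
  (ℕ.≤-trans le (subst (∣ X ∣ ≤_) (∣⁅x⁆∣≡1 x) (p⊆q⇒∣p∣≤∣q∣ λ {y} y∈ →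
    subst (_∈ₛ ⁅ x ⁆) (sym (decidable-stable (y ≟ x) λ y≢ → none (y , y∈ , y≢))) (x∈⁅x⁆ x))))
  λ { (s≤s ()) }

-- The rank function for graphs that are not tall: there, sizes 1 and 2 exclude each other within a
-- chain and together form one level.
merge : ℕ → ℕ
merge 2 = 1
merge k = k

merge-id : ∀ {k} → k ≢ 2 → merge k ≡ k
merge-id {0} _ = refl
merge-id {1} _ = refl
merge-id {2} k≢2 = contradiction refl k≢2
merge-id {suc (suc (suc k))} _ = refl

merge-injective : ∀ j k → merge j ≡ merge k → j ≡ k ⊎ (j ≡ 1 × k ≡ 2) ⊎ (j ≡ 2 × k ≡ 1)
merge-injective 1 2 _ = inj₂ (inj₁ (refl , refl))
merge-injective 2 1 _ = inj₂ (inj₂ (refl , refl))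
merge-injective 2 2 _ = inj₁ refl
merge-injective 0 0 _ = inj₁ refl
merge-injective 1 1 _ = inj₁ refl
merge-injective (suc (suc (suc j))) (suc (suc (suc k))) e = inj₁ e
merge-injective 0 (suc (suc (suc _))) ()
merge-injective 1 (suc (suc (suc _))) ()
merge-injective 2 (suc (suc (suc _))) ()

module JordanDedekindSober (G : Graph) (simple : IsSimple G) (cubic : Cubic G) where

  open CubicGraph G simple cubic
  open Flats G simple cubic
  private variable
    x y z v w u a b c : V
    X Y J : Subset (size G)

  -- The local form of being K₃,₃: a connected cubic graph with such a vertex is K₃,₃.
  Homogeneous : V → Set
  Homogeneous x = ∀ {a b} → x ~ a → x ~ b → St G a ≡ St G b

  -- Every neighbour `y` of `a` is a twin of `x`: each neighbour of `x` is a twin of `a` and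
  -- therefore adjacent to `y`.
  homogeneous-step : Homogeneous x → x ~ a → Homogeneous a
  homogeneous-step {x} {a} hom xa {y} {y′} ay ay′ = trans (sym (twin ay)) (twin ay′)
    where
    twin : ∀ {y} → a ~ y → St G x ≡ St G y
    twin ay = St⊆⇒St≡ λ xb → ~-sym (St≡⇒~ (hom xa xb) ay)

  tall⇒¬homogeneous : Tall → ¬ (∀ x → Homogeneous x)
  tall⇒¬homogeneous (v , w , _ , x , _ , _ , vx , _ , vz , wx , _ , ¬wz , _) hom =
    ¬wz (St≡⇒~ (hom x (~-sym vx) (~-sym wx)) vz)

  St≟ : ∀ a b → Dec (St G a ≡ St G b)
  St≟ a b = Vec.≡-dec Bool._≟_ (St G a) (St G b)

  module _ (connected : Connected G) where

    homogeneous-everywhere : Homogeneous x → ∀ y → Homogeneous y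
    homogeneous-everywhere = ~-closed connected Homogeneous homogeneous-step

    module _ (jd : JordanDedekind G) (tall : Tall) where

      -- Twins `x`, `y` must be exhibited as a flat of size 2. Since the graph is tall, it is not
      -- homogeneous, so `x` has neighbours `a`, `b` with different stars, and St(a) ∩ St(b) = {x,
      -- y}. A flat contains both twins or neither, so no singleton fits below this pair.
      sober : Sober G
      sober x y x≡y with x ≟ y
      ... | yes e = e
      ... | no x≢y with Fin.any? (λ a → Fin.any? λ b → x ~? a ×-dec x ~? b ×-dec ¬? (St≟ a b))
      ...   | no none = contradiction (homogeneous-everywhere λ {a} {b} xa xb →
        decidable-stable (St≟ a b) λ ne → none (a , b , xa , xb , ne)) (tall⇒¬homogeneous tall)
      ...   | yes (a , b , xa , xb , a≢b) = ⊥-elim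
        (¬unique-intermediate F-flat (p∩q⊆p _ _) (inj₂ ∣F∣) jd tall λ flatX _ cmp → λ where
          (inj₂ e) → comparable-∣≡∣⇒≡ cmp (trans e (sym ∣F∣))
          (inj₁ e) → contradiction e (∣∣≢1 flatX cmp))
        where
        F = St G a ∩ St G b
        F-flat : Flat G F
        F-flat = ∩-flat (St-flat a) (St-flat b)
        ∣F∣ : ∣ F ∣ ≡ 2
        ∣F∣ = ∩-∣∣≡2 (~-sym xa) (~-sym (St≡⇒~ x≡y xa)) (~-sym xb) (~-sym (St≡⇒~ x≡y xb)) x≢y a≢b
        x∈F : x ∈ₛ F
        x∈F = x∈p∩q⁺ (~⇒∈St (~-sym xa) , ~⇒∈St (~-sym xb))
        y∈F : y ∈ₛ F
        y∈F = x∈p∩q⁺ (~⇒∈St (~-sym (St≡⇒~ x≡y xa)) , ~⇒∈St (~-sym (St≡⇒~ x≡y xb)))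
        F⊆xy : ∀ {t} → t ∈ₛ F → t ≡ x ⊎ t ≡ y
        F⊆xy {t} t∈ with t ≟ x | t ≟ y
        ... | yes e | _ = inj₁ e
        ... | no _ | yes e = inj₂ e
        ... | no t≢x | no t≢y = contradiction
          (subst (3 ≤_) ∣F∣ (unique⇒length≤∣∣ {X = F} ((t≢x ∷ t≢y ∷ []) ∷ (x≢y ∷ []) ∷ [] ∷ []) λ where
            (here refl) → t∈
            (there (here refl)) → x∈F
            (there (there (here refl))) → y∈F))
          λ { (s≤s (s≤s ())) }
        twins : Flat G X → ∀ {s t} → St G s ≡ St G t → s ∈ₛ X → t ∈ₛ X
        twins (W , refl) e s∈ = ∈StW⁺ {W} λ w∈ → ~-sym (St≡⇒~ e (~-sym (∈StW⁻ {W = W} s∈ w∈)))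
        both : Flat G X → ∀ {t} → t ∈ₛ X → t ≡ x ⊎ t ≡ y → x ∈ₛ X × y ∈ₛ X
        both flatX t∈ (inj₁ refl) = t∈ , twins flatX x≡y t∈
        both flatX t∈ (inj₂ refl) = twins flatX (sym x≡y) t∈ , t∈
        ∣∣≢1 : Flat G X → Comparable X F → ∣ X ∣ ≢ 1
        ∣∣≢1 {X} flatX cmp e with ∣∣≥1⇒Nonempty {X = X} (ℕ.≤-reflexive (sym e))
        ... | t , t∈ with both flatX t∈ (F⊆xy (comparable-∣≤∣⇒⊆ cmp
            (subst (_≤ ∣ F ∣) (sym e) (subst (1 ≤_) (sym ∣F∣) (s≤s z≤n))) t∈))
        ... | x∈ , y∈ = contradiction
          (subst (2 ≤_) e (unique⇒length≤∣∣ {X = X} ((x≢y ∷ []) ∷ [] ∷ []) λ where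
            (here refl) → x∈
            (there (here refl)) → y∈))
          λ { (s≤s ()) }

  -- The singleton is St(St(b)): a vertex adjacent to all neighbours of `b` has the same star as
  -- `b`.
  singleton-flat : Sober G → ∀ b → Flat G ⁅ b ⁆
  singleton-flat sob b = flat (St G b)
    (λ x∈ w∈ → subst (_ ~_) (sym (x∈⁅y⁆⇒x≡y b x∈)) (~-sym (∈St⇒~ w∈)))
    λ {x} h → subst (_∈ₛ ⁅ b ⁆) (sob b x (St⊆⇒St≡ λ bw → ~-sym (h (~⇒∈St bw)))) (x∈⁅x⁆ b)

  -- A flat of size 2 between {b} and St(a) would provide a square on the edge, so without a square
  -- {b} is the one intermediate flat of a maximal chain.
  squares : JordanDedekind G → Tall → Sober G → EveryEdgeInSquare G
  squares jd tall sob a b ab with Fin.any? (λ c → Fin.any? λ d →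
    ¬? (c ≟ b) ×-dec a ~? c ×-dec d ~? b ×-dec d ~? c ×-dec ¬? (d ≟ a))
  ... | yes (c , d , c≢b , ac , db , dc , d≢a) =
    d , c , (~⇒≢ ab , ≢-sym d≢a , ~⇒≢ ac , ~⇒≢ (~-sym db) , ≢-sym c≢b , ~⇒≢ dc)
    , ~-sym db , dc , ~-sym ac
  ... | no none = ⊥-elim
    (¬unique-intermediate (singleton-flat sob b) (λ x∈ → subst (_∈ₛ St G a) (sym (x∈⁅y⁆⇒x≡y b x∈)) (~⇒∈St ab))
      (inj₁ (∣⁅x⁆∣≡1 b)) jd tall λ {X} flatX X⊆ cmp → λ where
        (inj₁ e) → comparable-∣≡∣⇒≡ cmp (trans e (sym (∣⁅x⁆∣≡1 b)))
        (inj₂ e) → ⊥-elim (no-pair flatX X⊆ cmp e))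
    where
    Comparable-sym : Comparable X Y → Comparable Y X
    Comparable-sym = [ inj₂ , inj₁ ]′
    no-pair : Flat G X → X ⊆ St G a → Comparable X ⁅ b ⁆ → ∣ X ∣ ≢ 2
    -- If `W` had no element besides `a`, its flat would contain all of St(a). So some `d` other
    -- than `a` lies in `W`, and the second point `c` of the flat completes the square a, b, d, c.
    no-pair {X} (W , refl) X⊆ cmp e with Fin.any? (λ w → (w Subset.∈? W) ×-dec ¬? (w ≟ a))
    ... | no none′ = contradiction
      (subst₂ _≤_ (cubic a) e (p⊆q⇒∣p∣≤∣q∣ λ z∈ → ∈StW⁺ λ {w} w∈ → subst (_~ _)
        (sym (decidable-stable (w ≟ a) λ w≢a → none′ (w , w∈ , w≢a))) (∈St⇒~ z∈)))
      λ { (s≤s (s≤s ())) }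
    ... | yes (d , d∈ , d≢a) with ∣∣≥2⇒another {X = X} b (ℕ.≤-reflexive (sym e))
    ... | c , c∈ , c≢b = none (c , d , c≢b , ∈St⇒~ (X⊆ c∈) , ∈StW⁻ b∈ d∈ , ∈StW⁻ c∈ d∈ , d≢a)
      where
      b∈ : b ∈ₛ X
      b∈ = comparable-∣≤∣⇒⊆ (Comparable-sym cmp)
        (subst₂ _≤_ (sym (∣⁅x⁆∣≡1 b)) (sym e) (s≤s z≤n)) (x∈⁅x⁆ b)

  module MaximalChain {C} (max : IsMaximalChain G C) where

    member-flat : X ∈ C → Flat G X
    member-flat = All.lookup (proj₁ (proj₁ max))

    unique : Unique C
    unique = proj₁ (proj₂ (proj₁ max))

    comparable : X ∈ C → Y ∈ C → Comparable X Y
    comparable = proj₂ (proj₂ (proj₁ max)) _ _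

    member : Flat G X → (∀ {Y} → Y ∈ C → X ⊆ Y ⊎ Y ⊆ X) → X ∈ C
    member flatX cmp = proj₂ max _ flatX λ _ → cmp

    ⊤∈ : ⊤ ∈ C
    ⊤∈ = member ⊤-flat λ _ → inj₂ (⊆-max _)

    ⊥∈ : ⊥ ∈ C
    ⊥∈ = member ⊥-flat λ _ → inj₁ (⊆-min _)

    card-injective : X ∈ C → Y ∈ C → ∣ X ∣ ≡ ∣ Y ∣ → X ≡ Y
    card-injective X∈ Y∈ = comparable-∣≡∣⇒≡ (comparable X∈ Y∈)

    Has : ℕ → Set
    Has k = ∃[ X ] X ∈ C × ∣ X ∣ ≡ k

    has? : ∀ k → Dec (Has k)
    has? k with Any.any? (λ X → ∣ X ∣ ℕ.≟ k) C
    ... | yes p = yes (find p)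
    ... | no ¬p = no λ (_ , X∈ , e) → ¬p (lose X∈ e)

    member-cases : X ∈ C → X ≡ ⊤ ⊎ (∃[ w ] X ⊆ St G w × ∣ X ∣ ≤ 3)
    member-cases X∈ with flat-⊤⊎⊆St (member-flat X∈)
    ... | inj₁ e = inj₁ e
    ... | inj₂ (w , X⊆) = inj₂ (w , X⊆ , ⊆St⇒∣∣≤3 X⊆)

    -- Here `B` is the largest member below `⊤`. A star containing it is comparable with every
    -- member, so maximality puts that star into the chain.
    insert-St : ∀ {B} → B ∈ C → B ⊆ St G w → (∀ {Y} → Y ∈ C → Y ≡ ⊤ ⊎ ∣ Y ∣ ≤ ∣ B ∣) →
      ∃[ w ] St G w ∈ C
    insert-St {w} {B} B∈ B⊆ bound = w , member (St-flat w) λ Y∈ → cmp Y∈ (bound Y∈)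
      where
      cmp : Y ∈ C → Y ≡ ⊤ ⊎ ∣ Y ∣ ≤ ∣ B ∣ → Comparable (St G w) Y
      cmp _ (inj₁ refl) = inj₁ (⊆-max _)
      cmp Y∈ (inj₂ le) = inj₂ λ y∈ → B⊆ (comparable-∣≤∣⇒⊆ (comparable Y∈ B∈) le y∈)

    St-member : V → ∃[ w ] St G w ∈ C
    St-member v with has? 3 | has? 2 | has? 1
    ... | yes (X , X∈ , e) | _ | _ with member-cases X∈
    ...   | inj₁ refl = contradiction e (ℕ.<⇒≢ (∣St∣<∣⊤∣ v) ∘ sym)
    ...   | inj₂ (w , X⊆ , _) =
      w , subst (_∈ C) (⊆∧∣≥∣⇒≡ X⊆ (ℕ.≤-reflexive (trans (cubic w) (sym e)))) X∈
    St-member v | no ¬3 | yes (X , X∈ , e) | _ with member-cases X∈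
    ...   | inj₁ refl = contradiction (subst (3 <_) e (∣St∣<∣⊤∣ v)) λ { (s≤s (s≤s ())) }
    ...   | inj₂ (w , X⊆ , _) = insert-St X∈ X⊆ λ {Y} Y∈ → case member-cases Y∈ of λ where
      (inj₁ refl) → inj₁ refl
      (inj₂ (_ , _ , le)) → inj₂ (subst (∣ Y ∣ ≤_) (sym e) (s≤s⁻¹ (ℕ.≤∧≢⇒< le λ e′ → ¬3 (Y , Y∈ , e′))))
    St-member v | no ¬3 | no ¬2 | yes (X , X∈ , e) with member-cases X∈
    ...   | inj₁ refl = contradiction (subst (3 <_) e (∣St∣<∣⊤∣ v)) λ { (s≤s ()) }
    ...   | inj₂ (w , X⊆ , _) = insert-St X∈ X⊆ λ {Y} Y∈ → case member-cases Y∈ of λ where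
      (inj₁ refl) → inj₁ refl
      (inj₂ (_ , _ , le)) → inj₂ (subst (∣ Y ∣ ≤_) (sym e)
        (s≤s⁻¹ (ℕ.≤∧≢⇒< (s≤s⁻¹ (ℕ.≤∧≢⇒< le λ e′ → ¬3 (Y , Y∈ , e′))) λ e′ → ¬2 (Y , Y∈ , e′))))
    St-member v | no ¬3 | no ¬2 | no ¬1 = insert-St {w = v} ⊥∈ (⊆-min _) λ {Y} Y∈ →
      case member-cases Y∈ of λ where
        (inj₁ refl) → inj₁ refl
        (inj₂ (_ , _ , le)) → case ≤3-cases le of λ where
          (inj₁ e) → inj₂ (subst (_≤ _) (sym e) z≤n)
          (inj₂ (inj₁ e)) → contradiction (Y , Y∈ , e) ¬1
          (inj₂ (inj₂ (inj₁ e))) → contradiction (Y , Y∈ , e) ¬2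
          (inj₂ (inj₂ (inj₂ e))) → contradiction (Y , Y∈ , e) ¬3

    card-cases : X ∈ C → (∣ X ∣ ≡ 0 ⊎ ∣ X ∣ ≡ 1 ⊎ ∣ X ∣ ≡ 2 ⊎ ∣ X ∣ ≡ 3) ⊎ X ≡ ⊤
    card-cases X∈ with member-cases X∈
    ... | inj₁ e = inj₂ e
    ... | inj₂ (_ , _ , le) = inj₁ (≤3-cases le)

    -- The dual insertion: `B` is the smallest nonempty member, and any of its points gives a flat
    -- below everything but the empty set.
    insert-singleton : Sober G → ∀ {B} → B ∈ C → ∀ {b} → b ∈ₛ B →
      (∀ {Y} → Y ∈ C → ∣ Y ∣ ≡ 0 ⊎ ∣ B ∣ ≤ ∣ Y ∣) → Has 1
    insert-singleton sob {B} B∈ {b} b∈ bound =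
      ⁅ b ⁆ , member (singleton-flat sob b) (λ Y∈ → cmp Y∈ (bound Y∈)) , ∣⁅x⁆∣≡1 b
      where
      cmp : Y ∈ C → ∣ Y ∣ ≡ 0 ⊎ ∣ B ∣ ≤ ∣ Y ∣ → Comparable ⁅ b ⁆ Y
      cmp {Y} _ (inj₁ e) = inj₂ (∣∣≡0⇒⊆ {X = Y} e)
      cmp {Y} Y∈ (inj₂ le) = inj₁ λ x∈ → subst (_∈ₛ Y) (sym (x∈⁅y⁆⇒x≡y b x∈))
        (comparable-∣≤∣⇒⊆ (comparable B∈ Y∈) le b∈)

    has-1 : Sober G → V → Has 1
    has-1 sob v with has? 1 | has? 2
    ... | yes p | _ = p
    ... | no ¬1 | yes (B , B∈ , e) =
      insert-singleton sob B∈ (proj₂ (∣∣≥1⇒Nonempty {X = B} (subst (1 ≤_) (sym e) (s≤s z≤n))))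
        λ {Y} Y∈ → case card-cases Y∈ of λ where
          (inj₁ (inj₁ e′)) → inj₁ e′
          (inj₁ (inj₂ (inj₁ e′))) → contradiction (Y , Y∈ , e′) ¬1
          (inj₁ (inj₂ (inj₂ (inj₁ e′)))) → inj₂ (ℕ.≤-reflexive (trans e (sym e′)))
          (inj₁ (inj₂ (inj₂ (inj₂ e′)))) → inj₂ (subst₂ _≤_ (sym e) (sym e′) (s≤s (s≤s z≤n)))
          (inj₂ refl) → inj₂ (p⊆q⇒∣p∣≤∣q∣ (⊆-max B))
    ... | no ¬1 | no ¬2 with w , St∈ ← St-member v =
      insert-singleton sob St∈ (~⇒∈St (proj₂ (neighbour w)))
        λ {Y} Y∈ → case card-cases Y∈ of λ where
          (inj₁ (inj₁ e′)) → inj₁ e′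
          (inj₁ (inj₂ (inj₁ e′))) → contradiction (Y , Y∈ , e′) ¬1
          (inj₁ (inj₂ (inj₂ (inj₁ e′)))) → contradiction (Y , Y∈ , e′) ¬2
          (inj₁ (inj₂ (inj₂ (inj₂ e′)))) → inj₂ (ℕ.≤-reflexive (trans (cubic w) (sym e′)))
          (inj₂ refl) → inj₂ (p⊆q⇒∣p∣≤∣q∣ (⊆-max (St G w)))

    -- Between {b} and St(w) the square on the edge from `w` to `b` inserts St(w) ∩ St(d), where `d`
    -- is the corner opposite to `w`. Soberness keeps this intersection smaller than St(w).
    has-2 : Sober G → EveryEdgeInSquare G → V → Has 2
    has-2 sob square v with has? 2
    ... | yes p = p
    ... | no ¬2 with has-1 sob v | St-member v
    ... | X , X∈ , ∣X∣ | w , St∈ with ∣∣≥1⇒Nonempty {X = X} (ℕ.≤-reflexive (sym ∣X∣))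
    ... | b , b∈ = insert-pair (square w b (∈St⇒~ (X⊆St b∈)))
      where
      X⊆St : X ⊆ St G w
      X⊆St = comparable-∣≤∣⇒⊆ (comparable X∈ St∈) (subst₂ _≤_ (sym ∣X∣) (sym (cubic w)) (s≤s z≤n))
      X⊆⁅b⁆ : X ⊆ ⁅ b ⁆
      X⊆⁅b⁆ = subst (_⊆ ⁅ b ⁆) (⊆∧∣≥∣⇒≡ (λ x∈ → subst (_∈ₛ X) (sym (x∈⁅y⁆⇒x≡y b x∈)) b∈)
        (ℕ.≤-reflexive (trans ∣X∣ (sym (∣⁅x⁆∣≡1 b))))) id
      insert-pair : _ → Has 2
      insert-pair (d , c , (_ , w≢d , _ , _ , b≢c , _) , bd , dc , cw) =
        F , member (∩-flat (St-flat w) (St-flat d)) (λ Y∈ → cmp Y∈ (card-cases Y∈)) , ∣F∣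
        where
        wb = ∈St⇒~ (X⊆St b∈)
        F = St G w ∩ St G d
        ∣F∣ : ∣ F ∣ ≡ 2
        ∣F∣ = ∩-∣∣≡2 wb (~-sym cw) (~-sym bd) dc b≢c (w≢d ∘ sob w d)
        X⊆F : X ⊆ F
        X⊆F x∈ = subst (_∈ₛ F) (sym (x∈⁅y⁆⇒x≡y b (X⊆⁅b⁆ x∈))) (x∈p∩q⁺ (~⇒∈St wb , ~⇒∈St (~-sym bd)))
        cmp : Y ∈ C → (∣ Y ∣ ≡ 0 ⊎ ∣ Y ∣ ≡ 1 ⊎ ∣ Y ∣ ≡ 2 ⊎ ∣ Y ∣ ≡ 3) ⊎ Y ≡ ⊤ → Comparable F Y
        cmp {Y} _ (inj₁ (inj₁ e)) = inj₂ (∣∣≡0⇒⊆ {X = Y} e)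
        cmp Y∈ (inj₁ (inj₂ (inj₁ e))) with refl ← card-injective Y∈ X∈ (trans e (sym ∣X∣)) = inj₂ X⊆F
        cmp Y∈ (inj₁ (inj₂ (inj₂ (inj₁ e)))) = contradiction (_ , Y∈ , e) ¬2
        cmp Y∈ (inj₁ (inj₂ (inj₂ (inj₂ e))))
          with refl ← card-injective Y∈ St∈ (trans e (sym (cubic w))) = inj₁ (p∩q⊆p _ _)
        cmp _ (inj₂ refl) = inj₁ (⊆-max _)

    size≢ : V → ∀ {k} → k ≤ 3 → k ≢ ∣ ⊤ {size G} ∣
    size≢ v le refl = ℕ.<⇒≱ (∣St∣<∣⊤∣ v) le

    length≡5 : Sober G → EveryEdgeInSquare G → V → length C ≡ 5
    length≡5 sob square v = transversal-length ∣_∣ {L = 0 ∷ 1 ∷ 2 ∷ 3 ∷ ∣ ⊤ {size G} ∣ ∷ []} unique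
      (((λ ()) ∷ (λ ()) ∷ (λ ()) ∷ size≢ v z≤n ∷ [])
        ∷ ((λ ()) ∷ (λ ()) ∷ size≢ v (s≤s z≤n) ∷ [])
        ∷ ((λ ()) ∷ size≢ v (s≤s (s≤s z≤n)) ∷ [])
        ∷ (size≢ v (s≤s (s≤s (s≤s z≤n))) ∷ []) ∷ [] ∷ [])
      (λ X∈ → case card-cases X∈ of λ where
        (inj₁ (inj₁ e)) → here e
        (inj₁ (inj₂ (inj₁ e))) → there (here e)
        (inj₁ (inj₂ (inj₂ (inj₁ e)))) → there (there (here e))
        (inj₁ (inj₂ (inj₂ (inj₂ e)))) → there (there (there (here e)))
        (inj₂ refl) → there (there (there (there (here refl)))))
      card-injective
      λ where
        (here refl) → ⊥ , ⊥∈ , ∣⊥∣≡0 (size G)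
        (there (here refl)) → has-1 sob v
        (there (there (here refl))) → has-2 sob square v
        (there (there (there (here refl)))) →
          St G (proj₁ (St-member v)) , proj₂ (St-member v) , cubic _
        (there (there (there (there (here refl))))) → ⊤ , ⊤∈ , refl

    HasIntermediate : Set
    HasIntermediate = Has 1 ⊎ Has 2

    ∉StW⁻ : ¬ x ∈ₛ StW G J → ∃[ w ] w ∈ₛ J × ¬ w ~ x
    ∉StW⁻ {x} {J} x∉ with Fin.any? (λ w → (w Subset.∈? J) ×-dec ¬? (w ~? x))
    ... | yes p = p
    ... | no none = contradiction
      (∈StW⁺ λ {w} w∈ → decidable-stable (w ~? x) λ ¬wx → none (w , w∈ , ¬wx)) x∉

    -- Suppose X = {x} and Y = {x, y}. Some `u` among the vertices cutting out `X` misses `y`; `Y`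
    -- lies in a star St(v) with a further point `z`; some `w` among the vertices cutting out `Y`
    -- misses `z`. This is tallness.
    ¬tall⇒¬both : ¬ Tall → X ∈ C → Y ∈ C → ∣ X ∣ ≡ 1 → ∣ Y ∣ ≢ 2
    ¬tall⇒¬both {X} {Y} ¬tall X∈ Y∈ ∣X∣ ∣Y∣
      with ∣∣≥1⇒Nonempty {X = X} (ℕ.≤-reflexive (sym ∣X∣)) | member-flat X∈ | member-flat Y∈
    ... | x , x∈ | U , refl | W , refl with ∣∣≥2⇒another {X = Y} x (ℕ.≤-reflexive (sym ∣Y∣))
    ... | y , y∈ , y≢x with ∉StW⁻ {J = U} y∉ | member-cases Y∈
      where
      y∉ : ¬ y ∈ₛ X
      y∉ y∈X = contradiction (subst (2 ≤_) ∣X∣ (unique⇒length≤∣∣ {X = X} ((y≢x ∷ []) ∷ [] ∷ []) λ where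
        (here refl) → y∈X
        (there (here refl)) → x∈)) λ { (s≤s ()) }
    ... | _ | inj₁ e = contradiction (subst (3 <_) (trans (cong ∣_∣ (sym e)) ∣Y∣) (∣St∣<∣⊤∣ x))
      λ { (s≤s (s≤s ())) }
    ... | u , u∈ , ¬uy | inj₂ (v , Y⊆ , _) with Fin.any? (λ z → v ~? z ×-dec ¬? (z Subset.∈? Y))
    ... | no none = contradiction (subst₂ _≤_ (cubic v) ∣Y∣ (p⊆q⇒∣p∣≤∣q∣ λ {z} z∈ →
      decidable-stable (z Subset.∈? Y) λ z∉ → none (z , ∈St⇒~ z∈ , z∉))) λ { (s≤s (s≤s ())) }
    ... | yes (z , vz , z∉) with ∉StW⁻ {J = W} z∉
    ... | w , w∈ , ¬wz =
      ¬tall (v , w , u , x , y , z , ∈St⇒~ (Y⊆ x∈Y) , ∈St⇒~ (Y⊆ y∈) , vz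
        , ∈StW⁻ {W = W} x∈Y w∈ , ∈StW⁻ {W = W} y∈ w∈ , ¬wz , ∈StW⁻ {W = U} x∈ u∈ , ¬uy)
      where
      x∈Y : x ∈ₛ Y
      x∈Y = comparable-∣≤∣⇒⊆ (comparable X∈ Y∈) (subst₂ _≤_ (sym ∣X∣) (sym ∣Y∣) (s≤s z≤n)) x∈

    length≡4 : ¬ Tall → V → HasIntermediate → length C ≡ 4
    length≡4 ¬tall v has =
      transversal-length (merge ∘ ∣_∣) {L = 0 ∷ 1 ∷ 3 ∷ ∣ ⊤ {size G} ∣ ∷ []} unique
        (((λ ()) ∷ (λ ()) ∷ size≢ v z≤n ∷ []) ∷ ((λ ()) ∷ size≢ v (s≤s z≤n) ∷ [])
          ∷ (size≢ v (s≤s (s≤s (s≤s z≤n))) ∷ []) ∷ [] ∷ [])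
        (λ X∈ → case card-cases X∈ of λ where
          (inj₁ (inj₁ e)) → here (cong merge e)
          (inj₁ (inj₂ (inj₁ e))) → there (here (cong merge e))
          (inj₁ (inj₂ (inj₂ (inj₁ e)))) → there (here (cong merge e))
          (inj₁ (inj₂ (inj₂ (inj₂ e)))) → there (there (here (cong merge e)))
          (inj₂ refl) → there (there (there (here merge-⊤))))
        (λ {X} {Y} X∈ Y∈ e → case merge-injective ∣ X ∣ ∣ Y ∣ e of λ where
          (inj₁ e′) → card-injective X∈ Y∈ e′
          (inj₂ (inj₁ (∣X∣ , ∣Y∣))) → contradiction ∣Y∣ (¬tall⇒¬both ¬tall X∈ Y∈ ∣X∣)
          (inj₂ (inj₂ (∣X∣ , ∣Y∣))) → contradiction ∣X∣ (¬tall⇒¬both ¬tall Y∈ X∈ ∣Y∣))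
        λ where
          (here refl) → ⊥ , ⊥∈ , cong merge (∣⊥∣≡0 (size G))
          (there (here refl)) → case has of λ where
            (inj₁ (X , X∈ , e)) → X , X∈ , cong merge e
            (inj₂ (X , X∈ , e)) → X , X∈ , cong merge e
          (there (there (here refl))) →
            St G (proj₁ (St-member v)) , proj₂ (St-member v) , cong merge (cubic _)
          (there (there (there (here refl)))) → ⊤ , ⊤∈ , merge-⊤
      where
      merge-⊤ : merge ∣ ⊤ {size G} ∣ ≡ ∣ ⊤ {size G} ∣
      merge-⊤ = merge-id (≢-sym (size≢ v (s≤s (s≤s z≤n))))

    length≡3 : V → ¬ HasIntermediate → length C ≡ 3
    length≡3 v ¬has = transversal-length ∣_∣ {L = 0 ∷ 3 ∷ ∣ ⊤ {size G} ∣ ∷ []} unique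
      (((λ ()) ∷ size≢ v z≤n ∷ []) ∷ (size≢ v (s≤s (s≤s (s≤s z≤n))) ∷ []) ∷ [] ∷ [])
      (λ {X} X∈ → case card-cases X∈ of λ where
        (inj₁ (inj₁ e)) → here e
        (inj₁ (inj₂ (inj₁ e))) → contradiction (inj₁ (X , X∈ , e)) ¬has
        (inj₁ (inj₂ (inj₂ (inj₁ e)))) → contradiction (inj₂ (X , X∈ , e)) ¬has
        (inj₁ (inj₂ (inj₂ (inj₂ e)))) → there (here e)
        (inj₂ refl) → there (there (here refl)))
      card-injective
      λ where
        (here refl) → ⊥ , ⊥∈ , ∣⊥∣≡0 (size G)
        (there (here refl)) → St G (proj₁ (St-member v)) , proj₂ (St-member v) , cubic _
        (there (there (here refl))) → ⊤ , ⊤∈ , refl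

    hasIntermediate? : Dec HasIntermediate
    hasIntermediate? = has? 1 ⊎-dec has? 2

    -- The chain contains a star St(w). For `x` in it and `a` adjacent to `x`, the flat St(a) ∩
    -- St(w) is comparable with every member and contains `x`; it would be intermediate unless `a`
    -- and `w` are twins.
    ¬intermediate⇒homogeneous : V → ¬ HasIntermediate → ∃ Homogeneous
    ¬intermediate⇒homogeneous v ¬has with w , St∈ ← St-member v with x , wx ← neighbour w =
      x , λ xa xb → trans (same xa) (sym (same xb))
      where
      same : ∀ {a} → x ~ a → St G a ≡ St G w
      same {a} xa with St≟ a w
      ... | yes e = e
      ... | no a≢w = contradiction has ¬has
        where
        F = St G a ∩ St G w
        F∈ : F ∈ C
        F∈ = member (∩-flat (St-flat a) (St-flat w)) λ Y∈ → cmp Y∈ (card-cases Y∈)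
          where
          cmp : Y ∈ C → (∣ Y ∣ ≡ 0 ⊎ ∣ Y ∣ ≡ 1 ⊎ ∣ Y ∣ ≡ 2 ⊎ ∣ Y ∣ ≡ 3) ⊎ Y ≡ ⊤ → Comparable F Y
          cmp {Y} _ (inj₁ (inj₁ e)) = inj₂ (∣∣≡0⇒⊆ {X = Y} e)
          cmp Y∈ (inj₁ (inj₂ (inj₁ e))) = contradiction (inj₁ (_ , Y∈ , e)) ¬has
          cmp Y∈ (inj₁ (inj₂ (inj₂ (inj₁ e)))) = contradiction (inj₂ (_ , Y∈ , e)) ¬has
          cmp Y∈ (inj₁ (inj₂ (inj₂ (inj₂ e))))
            with refl ← card-injective Y∈ St∈ (trans e (sym (cubic w))) = inj₁ (p∩q⊆q _ _)
          cmp _ (inj₂ refl) = inj₁ (⊆-max _)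
        has : HasIntermediate
        has with ≤3-cases (⊆St⇒∣∣≤3 {X = F} (p∩q⊆p _ _))
        ... | inj₁ e = contradiction
          (∣∣≡0⇒⊆ {X = F} {Y = ⊥} e (x∈p∩q⁺ (~⇒∈St (~-sym xa) , ~⇒∈St wx))) ∉⊥
        ... | inj₂ (inj₁ e) = inj₁ (F , F∈ , e)
        ... | inj₂ (inj₂ (inj₁ e)) = inj₂ (F , F∈ , e)
        ... | inj₂ (inj₂ (inj₂ e)) = contradiction (∩-∣∣≡3⇒St≡ e) a≢w

    -- All vertices cutting out `X` are neighbours of one point of `X`, hence twins, so `X` contains
    -- a whole star.
    homogeneous⇒big : (∀ x → Homogeneous x) → X ∈ C → 1 ≤ ∣ X ∣ → 3 ≤ ∣ X ∣
    homogeneous⇒big {X} hom X∈ pos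
      with ∣∣≥1⇒Nonempty {X = X} pos | member-flat X∈ | member-cases X∈
    ... | x , _ | _ | inj₁ refl = ℕ.<⇒≤ (∣St∣<∣⊤∣ x)
    ... | x , x∈ | W , refl | inj₂ (w , X⊆ , _) = subst (_≤ ∣ X ∣) (cubic w)
      (p⊆q⇒∣p∣≤∣q∣ λ z∈ → ∈StW⁺ {W} λ u∈ →
        St≡⇒~ (hom x (~-sym (∈St⇒~ (X⊆ x∈))) (~-sym (∈StW⁻ {W = W} x∈ u∈))) (∈St⇒~ z∈))

    homogeneous⇒¬intermediate : (∀ x → Homogeneous x) → ¬ HasIntermediate
    homogeneous⇒¬intermediate hom (inj₁ (X , X∈ , e)) =
      contradiction (subst (3 ≤_) e (homogeneous⇒big hom X∈ (ℕ.≤-reflexive (sym e)))) λ { (s≤s ()) }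
    homogeneous⇒¬intermediate hom (inj₂ (X , X∈ , e)) =
      contradiction (subst (3 ≤_) e (homogeneous⇒big hom X∈ (subst (1 ≤_) (sym e) (s≤s z≤n))))
        λ { (s≤s (s≤s ())) }

  -- `Connected` admits the graph without vertices, whereas the chain arguments and the walk start
  -- from a vertex.
  empty-or-vertex : size G ≡ 0 ⊎ V
  empty-or-vertex with nonempty? (⊤ {size G})
  ... | yes (v , _) = inj₂ v
  ... | no empty = inj₁ (trans (sym (∣⊤∣≡n (size G))) (trans (cong ∣_∣ (Empty-unique empty)) (∣⊥∣≡0 (size G))))

  -- `⊤` is the only subset, so a chain has at most one member, and `chainLength` truncates to 0 in
  -- either case.
  empty⇒JD : size G ≡ 0 → JordanDedekind G
  empty⇒JD e C D maxC maxD =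
    trans (short C (MaximalChain.unique maxC)) (sym (short D (MaximalChain.unique maxD)))
    where
    short : ∀ C → Unique C → chainLength C ≡ 0
    short C u = ℕ.m≤n⇒m∸n≡0 (unique-⊆⇒length≤ {ys = ⊤ ∷ []} u λ {X} _ →
      here (⊆∧∣≥∣⇒≡ (⊆-max X) (subst (_≤ ∣ X ∣) (sym (trans (∣⊤∣≡n _) e)) z≤n)))

  -- Two maximal chains cannot differ in having an intermediate flat: if one has none, every vertex
  -- is homogeneous, and then no maximal chain has one.
  ¬tall⇒JD : Connected G → ¬ Tall → JordanDedekind G
  ¬tall⇒JD connected ¬tall with empty-or-vertex
  ... | inj₁ e = empty⇒JD e
  ... | inj₂ v = λ _ _ maxC maxD → cong (_∸ 1) (lengths maxC maxD
      (MaximalChain.hasIntermediate? maxC) (MaximalChain.hasIntermediate? maxD))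
    where
    open MaximalChain
    hom : ∃ Homogeneous → ∀ x → Homogeneous x
    hom (_ , h) = homogeneous-everywhere connected h
    lengths : ∀ {C D} (maxC : IsMaximalChain G C) (maxD : IsMaximalChain G D) →
      Dec (HasIntermediate maxC) → Dec (HasIntermediate maxD) → length C ≡ length D
    lengths maxC maxD (yes c) (yes d) = trans (length≡4 maxC ¬tall v c) (sym (length≡4 maxD ¬tall v d))
    lengths maxC maxD (no c) (no d) = trans (length≡3 maxC v c) (sym (length≡3 maxD v d))
    lengths maxC maxD (yes c) (no d) = contradiction c
      (homogeneous⇒¬intermediate maxC (hom (¬intermediate⇒homogeneous maxD v d)))
    lengths maxC maxD (no c) (yes d) = contradiction d
      (homogeneous⇒¬intermediate maxD (hom (¬intermediate⇒homogeneous maxC v c)))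

  sober∧squares⇒JD : Sober G → EveryEdgeInSquare G → JordanDedekind G
  sober∧squares⇒JD sob square with empty-or-vertex
  ... | inj₁ e = empty⇒JD e
  ... | inj₂ v = λ _ _ maxC maxD → cong (_∸ 1) (trans (MaximalChain.length≡5 maxC sob square v)
    (sym (MaximalChain.length≡5 maxD sob square v)))

-- Ladders

module LadderWalk (G : Graph) (simple : IsSimple G) (cubic : Cubic G) where

  open CubicGraph G simple cubic
  private variable x y z v w a b c d : V

  -- A walk along the two rails of a ladder, not assumed to be injective.
  record Walk : Set where
    field
      rail : Bool → ℕ → V
      rung : ∀ s i → rail s i ~ rail (not s) i
      forward : ∀ s i → rail s i ~ rail s (suc i)
      no-diagonal : ∀ s i → rail (not s) i ≢ rail s (suc i)
      no-return : ∀ s i → rail s i ≢ rail s (suc (suc i))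

  module _ (sober : Sober G) (square : EveryEdgeInSquare G) where

    three-common⇒≡ : a ≢ b → a ≢ c → b ≢ c →
      v ~ a → v ~ b → v ~ c → w ~ a → w ~ b → w ~ c → v ≡ w
    three-common⇒≡ ab ac bc va vb vc wa wb wc =
      sober _ _ (three-common⇒St≡ ab ac bc va vb vc wa wb wc)

    -- For neighbours `a`, `b` of `x`, this says that the path from `a` through `x` to `b` closes up
    -- to a square; `e` is its fourth vertex.
    Corner : V → V → V → Set
    Corner x a b = ∃[ e ] e ≢ x × a ~ e × b ~ e

    corner-sym : Corner x a b → Corner x b a
    corner-sym (e , e≢ , ae , be) = e , e≢ , be , ae

    corner : x ~ a → ∃[ d ] x ~ d × d ≢ a × Corner x a d
    corner {x} {a} xa with square x a xa
    ... | c , d , (_ , x≢c , _ , _ , a≢d , _) , ac , cd , dx =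
      d , ~-sym dx , ≢-sym a≢d , c , ≢-sym x≢c , ac , ~-sym cd

    -- The edge xy is shared by two squares at x.
    Rung : V → V → Set
    Rung x y = ∀ {a} → x ~ a → a ≢ y → Corner x y a

    corners⇒rung : x ~ y → x ~ a → x ~ b → y ≢ a → y ≢ b → a ≢ b →
      Corner x y a → Corner x y b → Rung x y
    corners⇒rung xy xa xb y≢a y≢b a≢b ca cb xz z≢y with cover xy xa xb y≢a y≢b a≢b xz
    ... | inj₁ refl = contradiction refl z≢y
    ... | inj₂ (inj₁ refl) = ca
    ... | inj₂ (inj₂ refl) = cb

    -- The square on a first edge uses two edges at `x`. The square on the third edge uses that edge
    -- and one of these two, and the edge common to both squares is the rung.
    rung-exists : ∀ x → ∃[ y ] x ~ y × Rung x y
    rung-exists x with neighbour x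
    ... | a , xa with corner xa
    ... | d , xd , d≢a , cad with third x a d
    ... | c , xc , c≢a , c≢d with corner xc
    ... | e , xe , e≢c , cce with cover xa xd xc (≢-sym d≢a) (≢-sym c≢a) (≢-sym c≢d) xe
    ... | inj₁ refl = a , xa ,
      corners⇒rung xa xd xc (≢-sym d≢a) (≢-sym c≢a) (≢-sym c≢d) cad (corner-sym cce)
    ... | inj₂ (inj₁ refl) = d , xd ,
      corners⇒rung xd xa xc d≢a (≢-sym c≢d) (≢-sym c≢a) (corner-sym cad) (corner-sym cce)
    ... | inj₂ (inj₂ refl) = contradiction refl e≢c

    module _ {x y a a′} (xy : x ~ y) (rung : Rung x y) (xa : x ~ a) (a≢y : a ≢ y)
      (ya′ : y ~ a′) (a′≢x : a′ ≢ x) (aa′ : a ~ a′) where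

      -- A square on az that avoids the corner a′z goes through x; then all three corners at x
      -- are closed, so G is K₄ or a cube, and a′z turns out to be closed as well.
      third-corner : a ~ z → z ≢ x → z ≢ a′ → Corner a a′ z
      third-corner {z} az z≢x z≢a′ with third x y a | corner az
      ... | b , xb , b≢y , b≢a | d , ad , d≢z , e , e≢a , ze , de
        with cover (~-sym xa) aa′ az (≢-sym a′≢x) (≢-sym z≢x) (≢-sym z≢a′) ad
      ... | inj₂ (inj₁ refl) = e , e≢a , de , ze
      ... | inj₂ (inj₂ refl) = contradiction refl d≢z
      ... | inj₁ refl with cover xy xa xb (≢-sym a≢y) (≢-sym b≢y) (≢-sym b≢a) de
      ...   | inj₂ (inj₁ refl) = contradiction refl e≢a
      ...   | inj₁ refl = contradiction (three-common⇒≡ (≢-sym a′≢x) (≢-sym z≢x) (≢-sym z≢a′)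
        (~-sym xa) aa′ az (~-sym xy) ya′ (~-sym ze)) a≢y
      ...   | inj₂ (inj₂ refl) = cube (rung xb b≢y)
        where
        zb = ze
        N-x : x ~ v → v ≡ y ⊎ v ≡ a ⊎ v ≡ b
        N-x = cover xy xa xb (≢-sym a≢y) (≢-sym b≢y) (≢-sym b≢a)
        N-a : a ~ v → v ≡ x ⊎ v ≡ a′ ⊎ v ≡ z
        N-a = cover (~-sym xa) aa′ az (≢-sym a′≢x) (≢-sym z≢x) (≢-sym z≢a′)
        ¬yz : ¬ y ~ z
        ¬yz yz = a≢y (three-common⇒≡ (≢-sym a′≢x) (≢-sym z≢x) (≢-sym z≢a′)
          (~-sym xa) aa′ az (~-sym xy) ya′ yz)
        cube : Corner x y b → Corner a a′ z
        cube (b′ , b′≢x , yb′ , bb′) with a′ ≟ b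
        -- Here the graph is K₄: `y` is adjacent to `b`, which forces y = z, and `x` closes the
        -- corner.
        ... | yes refl with cover (~-sym xb) (~-sym zb) bb′ (≢-sym z≢x) (≢-sym b′≢x) z≢b′ (~-sym ya′)
          where
          z≢b′ : z ≢ b′
          z≢b′ refl = ¬yz yb′
        ...   | inj₁ refl = contradiction refl (~⇒≢ xy)
        ...   | inj₂ (inj₁ refl) = x , ~⇒≢ xa , ~-sym xb , ~-sym xy
        ...   | inj₂ (inj₂ refl) = contradiction refl (~⇒≢ yb′)
        cube (b′ , b′≢x , yb′ , bb′) | no a′≢b with third a′ y a
        ... | g , a′g , g≢y , g≢a with corner a′g
        ... | d , a′d , d≢g , e , e≢a′ , ge , de = far d e a′d d≢g e≢a′ ge de
          where
          b′≢a′ : b′ ≢ a′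
          b′≢a′ refl = b′≢x (three-common⇒≡ (≢-sym a≢y) (≢-sym b≢y) (≢-sym b≢a)
            (~-sym ya′) (~-sym aa′) (~-sym bb′) xy xa xb)
          z≢b′ : z ≢ b′
          z≢b′ refl = ¬yz yb′
          ¬ba′ : ¬ b ~ a′
          ¬ba′ ba′ with cover (~-sym xb) (~-sym zb) bb′ (≢-sym z≢x) (≢-sym b′≢x) z≢b′ ba′
          ... | inj₁ e = a′≢x e
          ... | inj₂ (inj₁ e) = z≢a′ (sym e)
          ... | inj₂ (inj₂ e) = b′≢a′ (sym e)
          ¬xg : ¬ x ~ g
          ¬xg xg with N-x xg
          ... | inj₁ e = g≢y e
          ... | inj₂ (inj₁ e) = g≢a e
          ... | inj₂ (inj₂ refl) = ¬ba′ (~-sym a′g)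
          -- In the cube `g` is opposite to `x`. The square on `zh`, with `h` the third neighbour of
          -- `z`, either joins `h` to `a′` or passes through `b` and `b′`, which forces h = g.
          opposite : b′ ~ g → Corner a a′ z
          opposite b′g with third z a b
          ... | h , zh , h≢a , h≢b with corner zh
          ... | d , zd , d≢h , e , e≢z , he , de with cover (~-sym az) zb zh (≢-sym b≢a) (≢-sym h≢a) (≢-sym h≢b) zd
          ...   | inj₂ (inj₂ refl) = contradiction refl d≢h
          ...   | inj₁ refl with N-a de
          ...     | inj₂ (inj₁ refl) = h , h≢a , ~-sym he , zh
          ...     | inj₂ (inj₂ refl) = contradiction refl e≢z
          ...     | inj₁ refl with N-x (~-sym he)
          ...       | inj₁ refl = contradiction (~-sym zh) ¬yz
          ...       | inj₂ (inj₁ refl) = contradiction refl h≢a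
          ...       | inj₂ (inj₂ refl) = contradiction refl h≢b
          opposite b′g | h , zh , h≢a , h≢b | d , zd , d≢h , e , e≢z , he , de | inj₂ (inj₁ refl)
            with cover (~-sym xb) (~-sym zb) bb′ (≢-sym z≢x) (≢-sym b′≢x) z≢b′ de
          ...     | inj₂ (inj₁ refl) = contradiction refl e≢z
          ...     | inj₁ refl with N-x (~-sym he)
          ...       | inj₁ refl = contradiction (~-sym zh) ¬yz
          ...       | inj₂ (inj₁ refl) = contradiction refl h≢a
          ...       | inj₂ (inj₂ refl) = contradiction refl h≢b
          opposite b′g | h , zh , h≢a , h≢b | d , zd , d≢h , e , e≢z , he , de | inj₂ (inj₁ refl)
            | inj₂ (inj₂ refl) with cover (~-sym yb′) (~-sym bb′) b′g
                (≢-sym b≢y) (≢-sym g≢y) (λ { refl → ¬ba′ (~-sym a′g) }) (~-sym he)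
          ...       | inj₁ refl = contradiction (~-sym zh) ¬yz
          ...       | inj₂ (inj₁ refl) = contradiction refl h≢b
          ...       | inj₂ (inj₂ refl) = g , g≢a , a′g , zh
          -- The square on the edge from `a′` to `g` leaves `a′` through `a` or `y`. Through `a` it
          -- joins `g` to `z`, which closes the corner; through `y` it only yields that `b′` is
          -- adjacent to `g`.
          far : ∀ d e → a′ ~ d → d ≢ g → e ≢ a′ → g ~ e → d ~ e → Corner a a′ z
          far d e a′d d≢g e≢a′ ge de
            with cover (~-sym ya′) (~-sym aa′) a′g (≢-sym a≢y) (≢-sym g≢y) (≢-sym g≢a) a′d
          ... | inj₂ (inj₂ refl) = contradiction refl d≢g
          ... | inj₂ (inj₁ refl) with N-a de
          ...   | inj₁ refl = contradiction (~-sym ge) ¬xg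
          ...   | inj₂ (inj₁ refl) = contradiction refl e≢a′
          ...   | inj₂ (inj₂ refl) = g , g≢a , a′g , ~-sym ge
          far d e a′d d≢g e≢a′ ge de | inj₁ refl
            with cover (~-sym xy) ya′ yb′ (≢-sym a′≢x) (≢-sym b′≢x) (≢-sym b′≢a′) de
          ...   | inj₁ refl = contradiction (~-sym ge) ¬xg
          ...   | inj₂ (inj₁ refl) = contradiction refl e≢a′
          ...   | inj₂ (inj₂ refl) = opposite (~-sym ge)

      -- One corner at `a` is closed by the square x, y, a′, a itself, the other by `third-corner`.
      rung-step : Rung a a′
      rung-step with third a x a′
      ... | z , az , z≢x , z≢a′ =
        corners⇒rung aa′ (~-sym xa) az a′≢x (≢-sym z≢a′) (≢-sym z≢x)
          (y , ≢-sym a≢y , ~-sym ya′ , xy) (third-corner az z≢x z≢a′)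

    -- Two successive rungs `pq` and `rs`. Only the front one carries the property `Rung`, which is
    -- what continues the ladder.
    record Rungs : Set where
      field
        {p q r s} : V
        pq : p ~ q
        rs : r ~ s
        pr : p ~ r
        qs : q ~ s
        p≢s : p ≢ s
        q≢r : q ≢ r
        rung : Rung r s

    module _ (R : Rungs) where
      open Rungs R

      r⁺∃ : ∃[ z ] r ~ z × z ≢ p × z ≢ s
      r⁺∃ = third r p s

      r⁺ s⁺ : V
      r⁺ = proj₁ r⁺∃

      rr⁺ : r ~ r⁺
      rr⁺ = proj₁ (proj₂ r⁺∃)

      p≢r⁺ : p ≢ r⁺
      p≢r⁺ = ≢-sym (proj₁ (proj₂ (proj₂ r⁺∃)))

      s≢r⁺ : s ≢ r⁺
      s≢r⁺ = ≢-sym (proj₂ (proj₂ (proj₂ r⁺∃)))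

      s⁺∃ : Corner r s r⁺
      s⁺∃ = rung rr⁺ (≢-sym s≢r⁺)

      s⁺ = proj₁ s⁺∃

      r≢s⁺ : r ≢ s⁺
      r≢s⁺ = ≢-sym (proj₁ (proj₂ s⁺∃))

      ss⁺ : s ~ s⁺
      ss⁺ = proj₁ (proj₂ (proj₂ s⁺∃))

      r⁺s⁺ : r⁺ ~ s⁺
      r⁺s⁺ = proj₂ (proj₂ (proj₂ s⁺∃))

      -- Otherwise `q` and `r` share the three neighbours `p`, `s`, `r⁺`, and soberness identifies
      -- them.
      q≢s⁺ : q ≢ s⁺
      q≢s⁺ q≡s⁺ = q≢r (three-common⇒≡ p≢s p≢r⁺ s≢r⁺
        (~-sym pq) qs (subst (_~ r⁺) (sym q≡s⁺) (~-sym r⁺s⁺)) (~-sym pr) rs rr⁺)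

      next : Rungs
      next = record
        { pq = rs ; rs = r⁺s⁺ ; pr = rr⁺ ; qs = ss⁺ ; p≢s = r≢s⁺ ; q≢r = s≢r⁺
        ; rung = rung-step rs rung rr⁺ (≢-sym s≢r⁺) ss⁺ (≢-sym r≢s⁺) r⁺s⁺ }

    first : V → Rungs
    first p with rung-exists p
    ... | q , pq , rung with another p q
    ... | r , pr , r≢q with rung pr r≢q
    ... | s , s≢p , qs , rs = record
      { pq = pq ; rs = rs ; pr = pr ; qs = qs ; p≢s = ≢-sym s≢p ; q≢r = ≢-sym r≢q
      ; rung = rung-step pq rung pr r≢q qs s≢p rs }

    walk : V → Walk
    walk v = record
      { rail = rail
      ; rung = λ { false i → Rungs.pq (rungs i) ; true i → ~-sym (Rungs.pq (rungs i)) }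
      ; forward = λ { false i → Rungs.pr (rungs i) ; true i → Rungs.qs (rungs i) }
      ; no-diagonal = λ { false i → Rungs.q≢r (rungs i) ; true i → Rungs.p≢s (rungs i) }
      ; no-return = λ { false i → p≢r⁺ (rungs i) ; true i → q≢s⁺ (rungs i) }
      }
      where
      rungs : ℕ → Rungs
      rungs zero = first v
      rungs (suc i) = next (rungs i)
      rail : Bool → ℕ → V
      rail false i = Rungs.p (rungs i)
      rail true i = Rungs.q (rungs i)

anyBool? : {P : Bool → Set} → (∀ b → Dec (P b)) → Dec (∃ P)
anyBool? P? = map′ [ (false ,_) , (true ,_) ]′ (λ { (false , p) → inj₁ p ; (true , p) → inj₂ p })
  (P? false ⊎-dec P? true)

least : {P : ℕ → Set} → (∀ n → Dec (P n)) → ∀ n → P n → ∃[ m ] P m × (∀ k → k < m → ¬ P k)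
least {P} P? = <-rec _ λ n smaller pn → case ℕ.anyUpTo? P? n of λ where
  (yes (m , m<n , pm)) → smaller m<n pm
  (no none) → n , pn , λ k k<n pk → none (k , k<n , pk)

≡-or-not : ∀ s t → t ≡ s ⊎ t ≡ not s
≡-or-not false false = inj₁ refl
≡-or-not false true = inj₂ refl
≡-or-not true false = inj₂ refl
≡-or-not true true = inj₁ refl

xor-twice : ∀ s τ → (s xor τ) xor τ ≡ s
xor-twice false false = refl
xor-twice false true = refl
xor-twice true false = refl
xor-twice true true = refl

-- Adjacency in the ladder of length suc M whose ends are glued with a twist iff τ holds.
data Ladder (τ : Bool) (M : ℕ) : Bool → ℕ → Bool → ℕ → Set where
  rung : ∀ {s i} → Ladder τ M s i (not s) i
  up   : ∀ {s i} → Ladder τ M s i s (suc i)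
  down : ∀ {s i} → Ladder τ M s (suc i) s i
  wrap↑ : ∀ {s} → Ladder τ M s M (s xor τ) 0
  wrap↓ : ∀ {s} → Ladder τ M s 0 (s xor τ) M

-- The first repetition of a walk along a ladder

module WalkClosing (G : Graph) (simple : IsSimple G) (cubic : Cubic G) where

  open CubicGraph G simple cubic
  open LadderWalk G simple cubic using (Walk)
  private variable z : V

  -- The ladder has rungs at levels 0 to `M`, and level `suc M` is level 0 again, with the rails
  -- exchanged iff `τ`. The field `no-return` is kept to rule out the untwisted ladder with two
  -- rungs.
  record ClosedWalk : Set where
    field
      rail : Bool → ℕ → V
      τ : Bool
      M : ℕ
      M≥1 : 1 ≤ M
      injective : ∀ {i j s t} → i ≤ M → j ≤ M → rail s i ≡ rail t j → i ≡ j × s ≡ t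
      no-return : ∀ s i → rail s i ≢ rail s (suc (suc i))
      closing : ∀ s → rail s (suc M) ≡ rail (s xor τ) 0
      ladder⇒~ : ∀ {s i t j} → Ladder τ M s i t j → rail s i ~ rail t j
      ~⇒ladder : ∀ {s i} → i ≤ M → rail s i ~ z →
        ∃[ t ] ∃[ j ] j ≤ M × z ≡ rail t j × Ladder τ M s i t j

  module _ (W : Walk) where
    open Walk W renaming (rung to rail-rung)

    no-diagonal′ : ∀ s i → rail s i ≢ rail (not s) (suc i)
    no-diagonal′ false = no-diagonal true
    no-diagonal′ true = no-diagonal false

    -- The two inequality fields of `Walk` are what makes these three neighbours distinct.
    cover-suc : ∀ s i → rail s (suc i) ~ z →
      z ≡ rail s i ⊎ z ≡ rail (not s) (suc i) ⊎ z ≡ rail s (suc (suc i))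
    cover-suc s i = cover (~-sym (forward s i)) (rail-rung s (suc i)) (forward s (suc i))
      (no-diagonal′ s i) (no-return s i) (no-diagonal s (suc i))

    Meets : ℕ → Set
    Meets n = ∃[ j ] j < n × ∃[ s ] ∃[ t ] rail s n ≡ rail t j

    meets? : ∀ n → Dec (Meets n)
    meets? n = ℕ.anyUpTo? (λ j → anyBool? λ s → anyBool? λ t → rail s n ≟ rail t j) n

    some-meeting : ∃ Meets
    some-meeting with Fin.pigeonhole (ℕ.n<1+n (size G)) (λ i → rail false (toℕ i))
    ... | i , j , i<j , e = toℕ j , toℕ i , i<j , false , false , sym e

    module FirstMeeting {N s₀ t₀ j₀} (j₀≤N : j₀ ≤ N) (meet : rail s₀ (suc N) ≡ rail t₀ j₀)
      (first : ∀ {k} → k ≤ N → ¬ Meets k) where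

      injective : ∀ {i j s t} → i ≤ N → j ≤ N → rail s i ≡ rail t j → i ≡ j × s ≡ t
      injective {i} {j} {s} {t} i≤ j≤ e with ℕ.<-cmp i j
      ... | tri< i<j _ _ = contradiction (i , i<j , t , s , sym e) (first j≤)
      ... | tri> _ _ j<i = contradiction (j , j<i , s , t , e) (first i≤)
      ... | tri≈ _ refl _ with ≡-or-not s t
      ...   | inj₁ refl = refl , refl
      ...   | inj₂ refl = contradiction e (~⇒≢ (rail-rung s i))

      -- At a positive level all three neighbours of the vertex met are known, on its own and the
      -- two adjacent levels. The vertex `rail s N` would be one of them; having no earlier
      -- repetition leaves a few coincidences, all excluded by edges, `no-diagonal` and `no-return`.
      meeting-level : ∀ {s t j} → j ≤ N → rail s (suc N) ≡ rail t j → j ≡ 0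
      meeting-level {j = zero} _ _ = refl
      meeting-level {s} {t} {suc j} j<N e
        with cover-suc t j (subst (_~ rail s N) e (~-sym (forward s N)))
      ... | inj₁ e′ = contradiction (sym (proj₁ (injective ℕ.≤-refl (ℕ.<⇒≤ j<N) e′))) (ℕ.<⇒≢ j<N)
      ... | inj₂ (inj₁ e′) with refl , refl ← injective ℕ.≤-refl j<N e′ =
        contradiction (sym e) (no-diagonal′ t (suc j))
      ... | inj₂ (inj₂ e′) with ℕ.m≤n⇒m<n∨m≡n j<N
      ...   | inj₁ j+1<N with refl , refl ← injective ℕ.≤-refl j+1<N e′ =
        contradiction (sym e) (no-return s (suc j))
      ...   | inj₂ refl with ≡-or-not s t
      ...     | inj₁ refl = contradiction (sym e) (~⇒≢ (forward s (suc j)))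
      ...     | inj₂ refl = contradiction (sym e) (no-diagonal s (suc j))

      N≥1 : 1 ≤ N
      N≥1 = pos N j₀≤N meet
        where
        pos : ∀ N → j₀ ≤ N → rail s₀ (suc N) ≡ rail t₀ j₀ → 1 ≤ N
        pos (suc _) _ _ = s≤s z≤n
        pos zero z≤n e with ≡-or-not s₀ t₀
        ... | inj₁ refl = contradiction (sym e) (~⇒≢ (forward s₀ 0))
        ... | inj₂ refl = contradiction (sym e) (no-diagonal s₀ 0)

      cover-zero : ∀ {s t} → rail s (suc N) ≡ rail t 0 → rail t 0 ~ z →
        z ≡ rail t 1 ⊎ z ≡ rail (not t) 0 ⊎ z ≡ rail s N
      cover-zero {s = s} {t} e = cover (forward t 0) (rail-rung t 0)
        (subst (_~ rail s N) e (~-sym (forward s N))) (≢-sym (no-diagonal t 0))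
        (λ e′ → case injective N≥1 ℕ.≤-refl e′ of λ { (refl , refl) → no-return s 0 (sym e) })
        λ e′ → ℕ.<⇒≢ N≥1 (proj₁ (injective z≤n ℕ.≤-refl e′))

      meet₀ : rail s₀ (suc N) ≡ rail t₀ 0
      meet₀ = trans meet (cong (rail t₀) (meeting-level j₀≤N meet))

      -- Both rails close at the same level. The other end of the new rung is a neighbour of
      -- `rail t₀ 0`; level 1 is excluded by `meeting-level`, and `rail s₀ N` by `no-diagonal`.
      meet₁ : rail (not s₀) (suc N) ≡ rail (not t₀) 0
      meet₁ with cover-zero meet₀ (subst (_~ rail (not s₀) (suc N)) meet₀ (rail-rung s₀ (suc N)))
      ... | inj₁ e = contradiction (meeting-level N≥1 e) λ ()
      ... | inj₂ (inj₁ e) = e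
      ... | inj₂ (inj₂ e) = contradiction (sym e) (no-diagonal′ s₀ N)

      τ : Bool
      τ = s₀ xor t₀

      closing : ∀ s → rail s (suc N) ≡ rail (s xor τ) 0
      closing = go s₀ t₀ meet₀ meet₁
        where
        go : ∀ s₀ t₀ → rail s₀ (suc N) ≡ rail t₀ 0 → rail (not s₀) (suc N) ≡ rail (not t₀) 0 →
          ∀ s → rail s (suc N) ≡ rail (s xor (s₀ xor t₀)) 0
        go false false e e′ false = e
        go false false e e′ true = e′
        go false true e e′ false = e
        go false true e e′ true = e′
        go true false e e′ false = e′
        go true false e e′ true = e
        go true true e e′ false = e′
        go true true e e′ true = e

      closing′ : ∀ s → rail (s xor τ) (suc N) ≡ rail s 0
      closing′ s = trans (closing (s xor τ)) (cong (λ t → rail t 0) (xor-twice s τ))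

      ladder⇒~ : ∀ {s i t j} → Ladder τ N s i t j → rail s i ~ rail t j
      ladder⇒~ {s} {i} rung = rail-rung s i
      ladder⇒~ {s} {i} up = forward s i
      ladder⇒~ {s} {i} down = ~-sym (forward s _)
      ladder⇒~ {s} wrap↑ = subst (rail s N ~_) (closing s) (forward s N)
      ladder⇒~ {s} wrap↓ = subst (_~ rail (s xor τ) N) (closing′ s) (~-sym (forward (s xor τ) N))

      ~⇒ladder : ∀ {s i} → i ≤ N → rail s i ~ z →
        ∃[ t ] ∃[ j ] j ≤ N × z ≡ rail t j × Ladder τ N s i t j
      ~⇒ladder {s = s} {zero} _ adj with cover-zero (closing′ s) adj
      ... | inj₁ e = s , 1 , N≥1 , e , up
      ... | inj₂ (inj₁ e) = not s , 0 , z≤n , e , rung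
      ... | inj₂ (inj₂ e) = s xor τ , N , ℕ.≤-refl , e , wrap↓
      ~⇒ladder {s = s} {suc i} i<N adj with cover-suc s i adj
      ... | inj₁ e = s , i , ℕ.<⇒≤ i<N , e , down
      ... | inj₂ (inj₁ e) = not s , suc i , i<N , e , rung
      ... | inj₂ (inj₂ e) with ℕ.m≤n⇒m<n∨m≡n i<N
      ...   | inj₁ i+1<N = s , suc (suc i) , i+1<N , e , up
      ...   | inj₂ refl = s xor τ , 0 , z≤n , trans e (closing s) , wrap↑

      closed : ClosedWalk
      closed = record
        { M = N ; M≥1 = N≥1 ; injective = injective ; no-return = no-return ; closing = closing
        ; ladder⇒~ = ladder⇒~ ; ~⇒ladder = ~⇒ladder }

    closed-walk : ClosedWalk
    closed-walk with least meets? (proj₁ some-meeting) (proj₂ some-meeting)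
    ... | zero , (_ , () , _) , _
    ... | suc N , (j , s≤s j≤N , s , t , e) , first = FirstMeeting.closed j≤N e λ k≤N → first _ (s≤s k≤N)

-- Coordinates for `H` and `H̃`

module LadderModels where

  private variable n : ℕ

  Position : ℕ → Set
  Position n = Fin n ⊎ Fin n

  side : Position n → Bool
  side (inj₁ _) = false
  side (inj₂ _) = true

  level : Position n → ℕ
  level (inj₁ i) = toℕ i
  level (inj₂ i) = toℕ i

  position : Bool → Fin n → Position n
  position false = inj₁
  position true = inj₂

  position-injective : (p q : Position n) → level p ≡ level q → side p ≡ side q → p ≡ q
  position-injective (inj₁ i) (inj₁ j) e _ = cong inj₁ (Fin.toℕ-injective e)
  position-injective (inj₂ i) (inj₂ j) e _ = cong inj₂ (Fin.toℕ-injective e)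

  side-position : ∀ s (i : Fin n) → side (position s i) ≡ s
  side-position false i = refl
  side-position true i = refl

  level-position : ∀ s (i : Fin n) → level (position s i) ≡ toℕ i
  level-position false i = refl
  level-position true i = refl

  level<n : (p : Position n) → level p < n
  level<n (inj₁ i) = Fin.toℕ<n i
  level<n (inj₂ i) = Fin.toℕ<n i

  path : ℕ → ℕ → Bool
  path i j = ⌊ j ℕ.≟ suc i ⌋ ∨ ⌊ i ℕ.≟ suc j ⌋

  cycle cross : ℕ → ℕ → ℕ → Bool
  cycle n i j = ⌊ j ℕ.≟ suc i ⌋ ∨ ⌊ i ℕ.≟ suc j ⌋
    ∨ (⌊ i ℕ.≟ 0 ⌋ ∧ ⌊ suc j ℕ.≟ n ⌋) ∨ (⌊ j ℕ.≟ 0 ⌋ ∧ ⌊ suc i ℕ.≟ n ⌋)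
  cross n i j = ⌊ i ℕ.≟ j ⌋ ∨ (⌊ suc i ℕ.≟ n ⌋ ∧ ⌊ j ℕ.≟ 0 ⌋) ∨ (⌊ i ℕ.≟ 0 ⌋ ∧ ⌊ suc j ℕ.≟ n ⌋)

  ladder : Bool → ℕ → Bool → ℕ → Bool → ℕ → Bool
  ladder false n false i false j = cycle n i j
  ladder false n true i true j = cycle n i j
  ladder false n false i true j = ⌊ i ℕ.≟ j ⌋
  ladder false n true i false j = ⌊ i ℕ.≟ j ⌋
  ladder true n false i false j = path i j
  ladder true n true i true j = path i j
  ladder true n false i true j = cross n i j
  ladder true n true i false j = cross n i j

  -- A common form of `H n` and `H̃ n` in the coordinates `side` and `level`, so that one
  -- isomorphism proof serves both.
  model : Bool → ℕ → Graph
  model τ n = record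
    { size = n + n
    ; adj = λ x y → let p = splitAt n x; q = splitAt n y in ladder τ n (side p) (level p) (side q) (level q) }

  adj-H : ∀ n x y → adj (H n) x y ≡ adj (model false n) x y
  adj-H n x y with splitAt n x | splitAt n y
  ... | inj₁ _ | inj₁ _ = refl
  ... | inj₁ _ | inj₂ _ = refl
  ... | inj₂ _ | inj₁ _ = refl
  ... | inj₂ _ | inj₂ _ = refl

  adj-H̃ : ∀ n x y → adj (H̃ n) x y ≡ adj (model true n) x y
  adj-H̃ n x y with splitAt n x | splitAt n y
  ... | inj₁ _ | inj₁ _ = refl
  ... | inj₁ _ | inj₂ _ = refl
  ... | inj₂ _ | inj₁ _ = refl
  ... | inj₂ _ | inj₂ _ = refl

  ∨⁻ : ∀ {a b} → a ∨ b ≡ true → a ≡ true ⊎ b ≡ true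
  ∨⁻ {true} _ = inj₁ refl
  ∨⁻ {false} e = inj₂ e

  ∧⁻ : ∀ {a b} → a ∧ b ≡ true → a ≡ true × b ≡ true
  ∧⁻ {true} e = refl , e

  ⌊≟⌋⁻ : ∀ {i j} → ⌊ i ℕ.≟ j ⌋ ≡ true → i ≡ j
  ⌊≟⌋⁻ {i} {j} e with i ℕ.≟ j
  ... | yes i≡j = i≡j

  ⌊≟⌋-refl : ∀ i → ⌊ i ℕ.≟ i ⌋ ≡ true
  ⌊≟⌋-refl i with i ℕ.≟ i
  ... | yes _ = refl
  ... | no i≢i = contradiction refl i≢i

  module _ {M : ℕ} where

    path⁻ : ∀ {τ} s {i j} → path i j ≡ true → Ladder τ M s i s j
    path⁻ s {i} {j} e with ∨⁻ {⌊ j ℕ.≟ suc i ⌋} e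
    ... | inj₁ e with refl ← ⌊≟⌋⁻ {j} {suc i} e = up
    ... | inj₂ e with refl ← ⌊≟⌋⁻ {i} {suc j} e = down

    cycle⁻ : ∀ s {i j} → cycle (suc M) i j ≡ true → Ladder false M s i s j
    cycle⁻ s {i} {j} e with ∨⁻ {⌊ j ℕ.≟ suc i ⌋} e
    ... | inj₁ e with refl ← ⌊≟⌋⁻ {j} {suc i} e = up
    ... | inj₂ e with ∨⁻ {⌊ i ℕ.≟ suc j ⌋} e
    ...   | inj₁ e with refl ← ⌊≟⌋⁻ {i} {suc j} e = down
    ...   | inj₂ e with ∨⁻ {⌊ i ℕ.≟ 0 ⌋ ∧ ⌊ suc j ℕ.≟ suc M ⌋} e
    ...     | inj₁ e with e₁ , e₂ ← ∧⁻ {⌊ i ℕ.≟ 0 ⌋} e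
      with refl ← ⌊≟⌋⁻ {i} {0} e₁ | refl ← ⌊≟⌋⁻ {suc j} {suc M} e₂ =
      subst (λ t → Ladder false M s 0 t M) (Bool.xor-identityʳ s) wrap↓
    cycle⁻ s {i} {j} _ | inj₂ _ | inj₂ _ | inj₂ e with e₁ , e₂ ← ∧⁻ {⌊ j ℕ.≟ 0 ⌋} e
      with refl ← ⌊≟⌋⁻ {j} {0} e₁ | refl ← ⌊≟⌋⁻ {suc i} {suc M} e₂ =
      subst (λ t → Ladder false M s M t 0) (Bool.xor-identityʳ s) wrap↑

    xor-true : ∀ s → s xor true ≡ not s
    xor-true false = refl
    xor-true true = refl

    cross⁻ : ∀ s {i j} → cross (suc M) i j ≡ true → Ladder true M s i (not s) j
    cross⁻ s {i} {j} e with ∨⁻ {⌊ i ℕ.≟ j ⌋} e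
    ... | inj₁ e with refl ← ⌊≟⌋⁻ {i} {j} e = rung
    ... | inj₂ e with ∨⁻ {⌊ suc i ℕ.≟ suc M ⌋ ∧ ⌊ j ℕ.≟ 0 ⌋} e
    ...   | inj₁ e with e₁ , e₂ ← ∧⁻ {⌊ suc i ℕ.≟ suc M ⌋} e
      with refl ← ⌊≟⌋⁻ {suc i} {suc M} e₁ | refl ← ⌊≟⌋⁻ {j} {0} e₂ =
      subst (λ t → Ladder true M s M t 0) (xor-true s) wrap↑
    cross⁻ s {i} {j} _ | inj₂ _ | inj₂ e with e₁ , e₂ ← ∧⁻ {⌊ i ℕ.≟ 0 ⌋} e
      with refl ← ⌊≟⌋⁻ {i} {0} e₁ | refl ← ⌊≟⌋⁻ {suc j} {suc M} e₂ =
      subst (λ t → Ladder true M s 0 t M) (xor-true s) wrap↓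

    ladder⁻ : ∀ τ s t {i j} → ladder τ (suc M) s i t j ≡ true → Ladder τ M s i t j
    ladder⁻ false false false e = cycle⁻ false e
    ladder⁻ false true true e = cycle⁻ true e
    ladder⁻ false false true {i} {j} e with refl ← ⌊≟⌋⁻ {i} {j} e = rung
    ladder⁻ false true false {i} {j} e with refl ← ⌊≟⌋⁻ {i} {j} e = rung
    ladder⁻ true false false e = path⁻ false e
    ladder⁻ true true true e = path⁻ true e
    ladder⁻ true false true e = cross⁻ false e
    ladder⁻ true true false e = cross⁻ true e

    ∨⁺ʳ : ∀ a {b} → b ≡ true → a ∨ b ≡ true
    ∨⁺ʳ a refl = Bool.∨-zeroʳ a

    ∨⁺ˡ : ∀ {a b} → a ≡ true → a ∨ b ≡ true
    ∨⁺ˡ refl = refl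

    path⇒cycle : ∀ i j → path i j ≡ true → cycle (suc M) i j ≡ true
    path⇒cycle i j e with ∨⁻ {⌊ j ℕ.≟ suc i ⌋} e
    ... | inj₁ e = ∨⁺ˡ e
    ... | inj₂ e = ∨⁺ʳ ⌊ j ℕ.≟ suc i ⌋ (∨⁺ˡ e)

    path-up : ∀ i → path i (suc i) ≡ true
    path-up i = ∨⁺ˡ (⌊≟⌋-refl (suc i))

    path-down : ∀ i → path (suc i) i ≡ true
    path-down i = ∨⁺ʳ ⌊ i ℕ.≟ suc (suc i) ⌋ (⌊≟⌋-refl (suc i))

    cycle-wrap↑ : cycle (suc M) M 0 ≡ true
    cycle-wrap↑ = ∨⁺ʳ ⌊ M ℕ.≟ 1 ⌋ (∨⁺ʳ (⌊ M ℕ.≟ 0 ⌋ ∧ ⌊ 1 ℕ.≟ suc M ⌋) (⌊≟⌋-refl (suc M)))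

    cycle-wrap↓ : cycle (suc M) 0 M ≡ true
    cycle-wrap↓ = ∨⁺ʳ ⌊ M ℕ.≟ 1 ⌋ (∨⁺ˡ (⌊≟⌋-refl (suc M)))

    cross-rung : ∀ i → cross (suc M) i i ≡ true
    cross-rung i = ∨⁺ˡ (⌊≟⌋-refl i)

    cross-wrap↑ : cross (suc M) M 0 ≡ true
    cross-wrap↑ = ∨⁺ʳ ⌊ M ℕ.≟ 0 ⌋ (∨⁺ˡ (trans (Bool.∧-identityʳ _) (⌊≟⌋-refl (suc M))))

    cross-wrap↓ : cross (suc M) 0 M ≡ true
    cross-wrap↓ = ∨⁺ʳ ⌊ 0 ℕ.≟ M ⌋ (∨⁺ʳ (⌊ 1 ℕ.≟ suc M ⌋ ∧ ⌊ M ℕ.≟ 0 ⌋) (⌊≟⌋-refl (suc M)))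

    ladder⁺ : ∀ τ {s i t j} → Ladder τ M s i t j → ladder τ (suc M) s i t j ≡ true
    ladder⁺ false (rung {false} {i}) = ⌊≟⌋-refl i
    ladder⁺ false (rung {true} {i}) = ⌊≟⌋-refl i
    ladder⁺ false (up {false} {i}) = path⇒cycle i (suc i) (path-up i)
    ladder⁺ false (up {true} {i}) = path⇒cycle i (suc i) (path-up i)
    ladder⁺ false (down {false} {i}) = path⇒cycle (suc i) i (path-down i)
    ladder⁺ false (down {true} {i}) = path⇒cycle (suc i) i (path-down i)
    ladder⁺ false (wrap↑ {false}) = cycle-wrap↑
    ladder⁺ false (wrap↑ {true}) = cycle-wrap↑
    ladder⁺ false (wrap↓ {false}) = cycle-wrap↓
    ladder⁺ false (wrap↓ {true}) = cycle-wrap↓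
    ladder⁺ true (rung {false} {i}) = cross-rung i
    ladder⁺ true (rung {true} {i}) = cross-rung i
    ladder⁺ true (up {false} {i}) = path-up i
    ladder⁺ true (up {true} {i}) = path-up i
    ladder⁺ true (down {false} {i}) = path-down i
    ladder⁺ true (down {true} {i}) = path-down i
    ladder⁺ true (wrap↑ {false}) = cross-wrap↑
    ladder⁺ true (wrap↑ {true}) = cross-wrap↑
    ladder⁺ true (wrap↓ {false}) = cross-wrap↓
    ladder⁺ true (wrap↓ {true}) = cross-wrap↓

-- Isomorphism with the ladders, and the converse

module Classification (G : Graph) (simple : IsSimple G) (cubic : Cubic G)
  (connected : Connected G) where

  open CubicGraph G simple cubic
  open LadderWalk G simple cubic using (walk)
  open WalkClosing G simple cubic
  open LadderModels

  module _ (W : ClosedWalk) where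
    open ClosedWalk W

    N : ℕ
    N = suc M

    OnRails : V → Set
    OnRails z = ∃[ s ] ∃[ i ] i ≤ M × z ≡ rail s i

    -- Neighbours of rail vertices are again on the rails, so by connectedness the closed ladder is
    -- the whole graph.
    on-rails : ∀ z → OnRails z
    on-rails = ~-closed connected OnRails
      (λ { (s , i , i≤M , refl) adj → case ~⇒ladder i≤M adj of λ where
        (t , j , j≤M , e , _) → t , j , j≤M , e })
      (false , 0 , z≤n , refl)

    vertex : Fin (N + N) → V
    vertex k = let p = splitAt N k in rail (side p) (level p)

    vertex-injective : ∀ {k l} → vertex k ≡ vertex l → k ≡ l
    vertex-injective {k} {l} e with injective (s≤s⁻¹ (level<n (splitAt N k))) (s≤s⁻¹ (level<n (splitAt N l))) e
    ... | e₁ , e₂ = trans (sym (Fin.join-splitAt N N k)) (trans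
      (cong (join N N) (position-injective (splitAt N k) (splitAt N l) e₁ e₂)) (Fin.join-splitAt N N l))

    index : V → Fin (N + N)
    index z = let s , i , i≤M , _ = on-rails z in join N N (position s (fromℕ< (s≤s i≤M)))

    vertex-index : ∀ z → vertex (index z) ≡ z
    vertex-index z with s , i , i≤M , e ← on-rails z
      rewrite Fin.splitAt-join N N (position s (fromℕ< (s≤s i≤M)))
        | side-position s (fromℕ< (s≤s i≤M)) | level-position s (fromℕ< (s≤s i≤M))
        | Fin.toℕ-fromℕ< (s≤s i≤M) = sym e

    adj-vertex : ∀ k l → adj G (vertex k) (vertex l) ≡ adj (model τ N) k l
    adj-vertex k l = Bool.⇔→≡ (mk⇔ to from)
      where
      p = splitAt N k
      q = splitAt N l
      to : vertex k ~ vertex l → adj (model τ N) k l ≡ true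
      to adj with ~⇒ladder (s≤s⁻¹ (level<n p)) adj
      ... | t , j , j≤M , e , lad with injective (s≤s⁻¹ (level<n q)) j≤M e
      ... | refl , refl = ladder⁺ τ lad
      from : adj (model τ N) k l ≡ true → vertex k ~ vertex l
      from e = ladder⇒~ (ladder⁻ τ (side p) (side q) e)

    ≅-model : G ≅ model τ N
    ≅-model = mk↔ₛ′ index vertex (λ k → vertex-injective (vertex-index (vertex k))) vertex-index
      , λ x y → trans (cong₂ (adj G) (sym (vertex-index x)) (sym (vertex-index y)))
          (adj-vertex (index x) (index y))

  ≅-trans-adj : ∀ {n} {a b : Fin n → Fin n → Bool} → (∀ x y → a x y ≡ b x y) →
    G ≅ record { size = n ; adj = a } → G ≅ record { size = n ; adj = b }
  ≅-trans-adj h (f , e) = f , λ x y → trans (e x y) (h _ _)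

  -- Two path edges, two rungs and two crossing edges join all six pairs; the check is by
  -- evaluation.
  model-2≡K4 : ∀ x y → adj (model true 2) x y ≡ adj K4 x y
  model-2≡K4 = toWitness {a? = Fin.all? λ x → Fin.all? λ y → adj (model true 2) x y Bool.≟ adj K4 x y} _

  module _ (sober : Sober G) (square : EveryEdgeInSquare G) where

    classify : V → G ≅ K4 ⊎ (∃[ n ] 3 ≤ n × G ≅ H n) ⊎ (∃[ n ] 4 ≤ n × G ≅ H̃ n)
    classify v = go (closed-walk (walk sober square v))
      where
      go : ClosedWalk → G ≅ K4 ⊎ (∃[ n ] 3 ≤ n × G ≅ H n) ⊎ (∃[ n ] 4 ≤ n × G ≅ H̃ n)
      go W = cases τ M refl refl
        where
        open ClosedWalk W
        iso : ∀ {t m} → τ ≡ t → M ≡ m → G ≅ model t (suc m)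
        iso refl refl = ≅-model W
        cases : ∀ t m → τ ≡ t → M ≡ m → G ≅ K4 ⊎ (∃[ n ] 3 ≤ n × G ≅ H n) ⊎ (∃[ n ] 4 ≤ n × G ≅ H̃ n)
        cases t 0 _ refl = contradiction M≥1 λ ()
        -- Without a twist, two rungs would put level 2 of a rail back on its level 0.
        cases false 1 refl refl = contradiction (sym (closing false)) (no-return false 0)
        cases false (suc (suc m)) et em = inj₂ (inj₁ (3 + m , s≤s (s≤s (s≤s z≤n)) ,
          ≅-trans-adj (λ x y → sym (adj-H (3 + m) x y)) (iso et em)))
        cases true 1 et em = inj₁ (≅-trans-adj model-2≡K4 (iso et em))
        -- The twisted ladder with three rungs is K₃,₃, in which `rail false 0` and `rail true 1`
        -- are twins.
        cases true 2 refl refl = contradiction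
          (sober (rail false 0) (rail true 1) (three-common⇒St≡
            {a = rail true 0} {rail false 1} {rail true 2}
            (λ e → case injective z≤n (s≤s z≤n) e of λ ())
            (λ e → case injective z≤n ℕ.≤-refl e of λ ())
            (λ e → case injective (s≤s z≤n) ℕ.≤-refl e of λ ())
            (ladder⇒~ rung) (ladder⇒~ up) (ladder⇒~ wrap↓)
            (ladder⇒~ down) (ladder⇒~ rung) (ladder⇒~ up)))
          λ e → case injective z≤n (s≤s z≤n) e of λ ()
        cases true (suc (suc (suc m))) et em = inj₂ (inj₂ (4 + m , s≤s (s≤s (s≤s (s≤s z≤n))) ,
          ≅-trans-adj (λ x y → sym (adj-H̃ (4 + m) x y)) (iso et em)))

  -- The exchange of v_i and w_i: an automorphism of order two that moves every vertex along its
  -- rung. It treats both twists at once: an edge off the rungs spans a square with its image, and a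
  -- rung spans one with the rung at another neighbour.
  record RailSwap : Set where
    field
      ρ : V → V
      involutive : ∀ x → ρ (ρ x) ≡ x
      rung-edge : ∀ x → x ~ ρ x
      preserves : ∀ {x y} → x ~ y → ρ x ~ ρ y

    injective : ∀ {x y} → ρ x ≡ ρ y → x ≡ y
    injective {x} {y} e = trans (sym (involutive x)) (trans (cong ρ e) (involutive y))

    squares : EveryEdgeInSquare G
    squares a b ab with b ≟ ρ a
    ... | no b≢ρa = ρ b , ρ a
      , (~⇒≢ ab , (λ { refl → b≢ρa (sym (involutive b)) }) , ~⇒≢ (rung-edge a)
        , ~⇒≢ (rung-edge b) , b≢ρa , ≢-sym (~⇒≢ ab ∘ injective))
      , rung-edge b , ~-sym (preserves ab) , ~-sym (rung-edge a)
    ... | yes refl with another a (ρ a)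
    ... | c , ac , c≢ρa = ρ c , c
      , (~⇒≢ ab , (λ { refl → c≢ρa (sym (involutive c)) }) , ~⇒≢ ac
        , ~⇒≢ ac ∘ injective , ≢-sym c≢ρa , ≢-sym (~⇒≢ (rung-edge c)))
      , preserves ac , ~-sym (rung-edge c) , ~-sym ac

    -- Twins x, y force the component {x, y, ρ c, ρ x, ρ y, c}, a K₃,₃.
    sober : 6 < size G → Sober G
    sober big x y x≡y with x ≟ y
    ... | yes e = e
    ... | no x≢y with third x (ρ x) (ρ y)
    ... | c , xc , c≢ρx , c≢ρy = contradiction
      (subst (_≤ 6) (length-tabulate id)
        (unique-⊆⇒length≤ (Unique.allFin⁺ (size G)) λ {z} _ →
          ~-closed connected (_∈ six) closed (here refl) z))
      (ℕ.<⇒≱ big)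
      where
      six = x ∷ y ∷ ρ c ∷ ρ x ∷ ρ y ∷ c ∷ []
      y~ρx : y ~ ρ x
      y~ρx = St≡⇒~ x≡y (rung-edge x)
      x~ρy : x ~ ρ y
      x~ρy = St≡⇒~ (sym x≡y) (rung-edge y)
      yc : y ~ c
      yc = St≡⇒~ x≡y xc
      like-x : ∀ {v} → v ~ ρ x → v ~ ρ y → v ~ c → ∀ {z} → v ~ z → z ∈ six
      like-x a b d vz with cover a b d (x≢y ∘ injective) (≢-sym c≢ρx) (≢-sym c≢ρy) vz
      ... | inj₁ refl = there (there (there (here refl)))
      ... | inj₂ (inj₁ refl) = there (there (there (there (here refl))))
      ... | inj₂ (inj₂ refl) = there (there (there (there (there (here refl)))))
      like-ρx : ∀ {v} → v ~ x → v ~ y → v ~ ρ c → ∀ {z} → v ~ z → z ∈ six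
      like-ρx a b d vz with cover a b d x≢y (λ { refl → c≢ρx (sym (involutive c)) })
        (λ { refl → c≢ρy (sym (involutive c)) }) vz
      ... | inj₁ refl = here refl
      ... | inj₂ (inj₁ refl) = there (here refl)
      ... | inj₂ (inj₂ refl) = there (there (here refl))
      closed : ∀ {u v} → u ∈ six → u ~ v → v ∈ six
      closed (here refl) = like-x (rung-edge x) x~ρy xc
      closed (there (here refl)) = like-x y~ρx (rung-edge y) yc
      closed (there (there (here refl))) =
        like-x (~-sym (preserves xc)) (~-sym (preserves yc)) (~-sym (rung-edge c))
      closed (there (there (there (here refl)))) =
        like-ρx (~-sym (rung-edge x)) (~-sym y~ρx) (preserves xc)
      closed (there (there (there (there (here refl))))) =
        like-ρx (~-sym x~ρy) (~-sym (rung-edge y)) (preserves yc)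
      closed (there (there (there (there (there (here refl)))))) =
        like-ρx (~-sym xc) (~-sym yc) (rung-edge c)

  module _ τ n (iso : G ≅ model τ n) where
    open Inverse (proj₁ iso) using (to; from; strictlyInverseˡ; strictlyInverseʳ)

    size≡ : size G ≡ n + n
    size≡ = ↔⇒≡ (proj₁ iso)

    flip-rail : Fin (n + n) → Fin (n + n)
    flip-rail k = join n n (swap (splitAt n k))

    side-swap : (p : Position n) → side (swap p) ≡ not (side p)
    side-swap (inj₁ _) = refl
    side-swap (inj₂ _) = refl

    level-swap : (p : Position n) → level (swap p) ≡ level p
    level-swap (inj₁ _) = refl
    level-swap (inj₂ _) = refl

    ladder-not : ∀ τ s t i j → ladder τ n (not s) i (not t) j ≡ ladder τ n s i t j
    ladder-not false false false _ _ = refl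
    ladder-not false false true _ _ = refl
    ladder-not false true false _ _ = refl
    ladder-not false true true _ _ = refl
    ladder-not true false false _ _ = refl
    ladder-not true false true _ _ = refl
    ladder-not true true false _ _ = refl
    ladder-not true true true _ _ = refl

    ladder-rung : ∀ τ s i → ladder τ n s i (not s) i ≡ true
    ladder-rung false false i = ⌊≟⌋-refl i
    ladder-rung false true i = ⌊≟⌋-refl i
    ladder-rung true false i rewrite ⌊≟⌋-refl i = refl
    ladder-rung true true i rewrite ⌊≟⌋-refl i = refl

    flip-involutive : ∀ k → flip-rail (flip-rail k) ≡ k
    flip-involutive k rewrite Fin.splitAt-join n n (swap (splitAt n k))
      | swap-involutive (splitAt n k) = Fin.join-splitAt n n k

    flip-preserves : ∀ k l → adj (model τ n) (flip-rail k) (flip-rail l) ≡ adj (model τ n) k l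
    flip-preserves k l
      rewrite Fin.splitAt-join n n (swap (splitAt n k)) | Fin.splitAt-join n n (swap (splitAt n l))
        | side-swap (splitAt n k) | side-swap (splitAt n l)
        | level-swap (splitAt n k) | level-swap (splitAt n l) = ladder-not τ _ _ _ _

    flip-rung : ∀ k → adj (model τ n) k (flip-rail k) ≡ true
    flip-rung k
      rewrite Fin.splitAt-join n n (swap (splitAt n k))
        | side-swap (splitAt n k) | level-swap (splitAt n k) = ladder-rung τ _ _

    adj-to : ∀ x y → adj G x y ≡ adj (model τ n) (to x) (to y)
    adj-to = proj₂ iso

    rail-swap : RailSwap
    rail-swap = record
      { ρ = from ∘ flip-rail ∘ to
      ; involutive = λ x → trans
          (cong (from ∘ flip-rail) (strictlyInverseˡ _))
          (trans (cong from (flip-involutive (to x))) (strictlyInverseʳ x))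
      ; rung-edge = λ x → trans (adj-to _ _)
          (trans (cong (adj (model τ n) (to x)) (strictlyInverseˡ _)) (flip-rung (to x)))
      ; preserves = λ {x} {y} xy → trans (adj-to _ _)
          (trans (cong₂ (adj (model τ n)) (strictlyInverseˡ _) (strictlyInverseˡ _))
            (trans (flip-preserves (to x) (to y)) (trans (sym (adj-to x y)) xy)))
      }

    model⇒squares : EveryEdgeInSquare G
    model⇒squares = RailSwap.squares rail-swap

    -- Four rungs give at least eight vertices, more than K₃,₃ has. With three rungs the twisted
    -- ladder is K₃,₃ itself, so `H 3` is settled separately, by evaluation.
    model⇒sober : 4 ≤ n → Sober G
    model⇒sober le = RailSwap.sober rail-swap
      (subst (7 ≤_) (sym size≡) (ℕ.≤-trans (s≤s (s≤s (s≤s (s≤s (s≤s (s≤s (s≤s z≤n))))))) (ℕ.+-mono-≤ le le)))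

  twin-free? : ∀ K → Dec (∀ v w → (∀ z → adj K v z ≡ adj K w z) → v ≡ w)
  twin-free? K = Fin.all? λ v → Fin.all? λ w →
    Fin.all? (λ z → adj K v z Bool.≟ adj K w z) →-dec (v ≟ w)

  ≅⇒sober : ∀ {K} → G ≅ K → (∀ v w → (∀ z → adj K v z ≡ adj K w z) → v ≡ w) → Sober G
  ≅⇒sober {K} (f , e) twin-free v w v≡w =
    trans (sym (strictlyInverseʳ v)) (trans (cong from same) (strictlyInverseʳ w))
    where
    open Inverse f using (to; from; strictlyInverseˡ; strictlyInverseʳ)
    same : to v ≡ to w
    same = twin-free (to v) (to w) λ z →
      subst (λ z → adj K (to v) z ≡ adj K (to w) z) (strictlyInverseˡ z)
        (trans (sym (e v (from z)))
          (trans (Bool.⇔→≡ (mk⇔ (St≡⇒~ v≡w) (St≡⇒~ (sym v≡w)))) (e w (from z))))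

  classified⇒sober : G ≅ K4 ⊎ (∃[ n ] 3 ≤ n × G ≅ H n) ⊎ (∃[ n ] 4 ≤ n × G ≅ H̃ n) → Sober G
  classified⇒sober (inj₁ iso) = ≅⇒sober iso (toWitness {a? = twin-free? K4} _)
  classified⇒sober (inj₂ (inj₂ (n , 4≤n , iso))) = model⇒sober true n (≅-trans-adj (adj-H̃ n) iso) 4≤n
  classified⇒sober (inj₂ (inj₁ (n , 3≤n , iso))) with ℕ.m≤n⇒m<n∨m≡n 3≤n
  ... | inj₁ 4≤n = model⇒sober false n (≅-trans-adj (adj-H n) iso) 4≤n
  ... | inj₂ refl = ≅⇒sober iso (toWitness {a? = twin-free? (H 3)} _)

  classified⇒squares : G ≅ K4 ⊎ (∃[ n ] 3 ≤ n × G ≅ H n) ⊎ (∃[ n ] 4 ≤ n × G ≅ H̃ n) →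
    EveryEdgeInSquare G
  classified⇒squares (inj₁ iso) = model⇒squares true 2 (≅-trans-adj (λ x y → sym (model-2≡K4 x y)) iso)
  classified⇒squares (inj₂ (inj₁ (n , _ , iso))) = model⇒squares false n (≅-trans-adj (adj-H n) iso)
  classified⇒squares (inj₂ (inj₂ (n , _ , iso))) = model⇒squares true n (≅-trans-adj (adj-H̃ n) iso)

theorem7p5 : (G : Graph) → IsSimple G → Cubic G → Connected G →
    (JordanDedekind G ⇔ (CRankAtMost G 3 ⊎ (Sober G × EveryEdgeInSquare G)))
    × (JordanDedekind G ⇔
    (CRankAtMost G 3 ⊎ G ≅ K4 ⊎ (∃[ n ] 3 ≤ n × G ≅ H n) ⊎ (∃[ n ] 4 ≤ n × G ≅ H̃ n)))
theorem7p5 G simple cubic connected =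
  mk⇔ jd⇒sober [ rank⇒jd , (λ (sob , square) → sober∧squares⇒JD sob square) ]′
  , mk⇔ (classify′ ∘ jd⇒sober)
      [ rank⇒jd , (λ c → sober∧squares⇒JD (classified⇒sober c) (classified⇒squares c)) ]′
  where
  open Flats G simple cubic
  open JordanDedekindRank G simple cubic
  open JordanDedekindSober G simple cubic
  open Classification G simple cubic connected
  rank⇒jd : CRankAtMost G 3 → JordanDedekind G
  rank⇒jd = ¬tall⇒JD connected ∘ rank≤3⇒¬tall
  jd⇒sober : JordanDedekind G → CRankAtMost G 3 ⊎ (Sober G × EveryEdgeInSquare G)
  jd⇒sober jd with tall?
  ... | no ¬tall = inj₁ (¬tall⇒rank≤3 ¬tall)
  ... | yes tall = inj₂ (sob , squares jd tall sob)
    where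
    sob = sober connected jd tall
  classify′ : CRankAtMost G 3 ⊎ (Sober G × EveryEdgeInSquare G) →
    CRankAtMost G 3 ⊎ G ≅ K4 ⊎ (∃[ n ] 3 ≤ n × G ≅ H n) ⊎ (∃[ n ] 4 ≤ n × G ≅ H̃ n)
  classify′ (inj₁ rank) = inj₁ rank
  classify′ (inj₂ (sob , square)) with empty-or-vertex
  ... | inj₂ v = inj₂ (classify sob square v)
  -- The empty graph is none of the listed graphs, but its rank is at most 0.
  ... | inj₁ empty = inj₁ λ J _ → ℕ.≤-trans (Subset.∣p∣≤n J) (subst (_≤ 3) (sym empty) z≤n)
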